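{- $\pi_{5.3}(\emptyset)=\pi_{5.7}(\emptyset)=\dfrac{20}{27}$.
   Context: A $3$-graph is a pair $G=(V,E)$ with $E$ a set of $3$-element subsets of $V$. For integers $m,k$, $m.k$ denotes the family of all $3$-graphs on $m$ vertices with exactly $k$ edges. For a $3$-graph $G$ on $n\ge m$ vertices, $e_{m.k}(G)$ is the number of $m$-element subsets of $V(G)$ spanning exactly $k$ edges of $G$, and $\pi_{m.k}(\emptyset)=\lim_{n\to\infty}\max\{e_{m.k}(G): |V(G)|=n\}/\binom{n}{m}$ (the limit exists). -}

module Defs where

open import Data.Bool using (Bool; true; false)
open import Data.Nat using (ℕ; zero; suc; _≡ᵇ_; _≥_)
open import Data.Nat.Combinatorics using (_C_)
open import Data.Fin using (Fin)
open import Data.List using (List; []; _∷_; map; _++_; length; filter; allFin)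
open import Data.Product using (Σ; _×_; ∃)
open import Data.Integer using (+_)
open import Data.Rational using (ℚ; _≤_; _+_; _-_; _*_; Positive; _/_)
open import Data.Bool.Properties using (_≟_)
open import Relation.Binary.PropositionalEquality using (_≡_)

choose : {A : Set} → ℕ → List A → List (List A)
choose zero    _        = [] ∷ []
choose (suc r) []       = []
choose (suc r) (x ∷ xs) = map (x ∷_) (choose r xs) ++ choose (suc r) xs

-- A 3-graph on vertex set Fin n: the triple {i,j,k} with i<j<k is an edge
-- iff G i j k ≡ true (values on non-increasing triples are irrelevant).
Graph3 : ℕ → Set
Graph3 n = Fin n → Fin n → Fin n → Bool

isEdge : ∀ {n} → Graph3 n → List (Fin n) → Bool
isEdge G (a ∷ b ∷ c ∷ []) = G a b c
isEdge G _                = false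

edgesIn : ∀ {n} → Graph3 n → List (Fin n) → ℕ
edgesIn G S = length (filter (λ T → isEdge G T ≟ true) (choose 3 S))

e[_∙_] : ℕ → ℕ → ∀ {n} → Graph3 n → ℕ
e[ m ∙ k ] {n} G =
  length (filter (λ S → edgesIn G S Data.Nat.≟ k) (choose m (allFin n)))

toℚ : ℕ → ℚ
toℚ x = + x / 1

-- π_{m.k}(∅) = r, i.e. max_{|V(G)|=n} e_{m.k}(G) / C(n,m) → r as n → ∞,
-- unfolded: for all ε > 0 there is N such that for all n ≥ N every G on n
-- vertices has density ≤ r + ε and some G on n vertices has density ≥ r - ε.
-- (Densities compared after multiplying through by C(n,m).)
PiIs : ℕ → ℕ → ℚ → Set
PiIs m k r =
  (ε : ℚ) → Positive ε →
  Σ ℕ λ N → (n : ℕ) → n ≥ N →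
    ((G : Graph3 n) → toℚ (e[ m ∙ k ] G) ≤ (r + ε) * toℚ (n C m))
    × (Σ (Graph3 n) λ G → (r - ε) * toℚ (n C m) ≤ toℚ (e[ m ∙ k ] G))

{-# OPTIONS --safe #-}
-- Complementation exchanges 3 and 7 edges on five vertices, so only π₅.₃ matters.
--
-- Lower bound: colour the vertices cyclically with 0, 1, 2 and let the edges be the triples coloured 001, 112
-- or 220. Five vertices span exactly three edges unless their colours split as 5+0+0, as 4+1+0, or as 3+2+0
-- in the wrong orientation; 63 of the 3⁵ colour sequences are bad.
--
-- Upper bound: a flag algebra argument on six vertices. For every 3-graph H on six labelled vertices,
--   27 · #{5-subsets of H with 3 edges} + (sums of products φ(u) φ(v) over all splittings into a 4-set and a
--   pair u, v) ≤ 120,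
-- where φ runs over forms in the edges that join u to the 4-set. Summed over all 6-tuples of vertices of G,
-- repetitions included, the products become squares (Σᵤ φ(u))² ≥ 0, so that at most (20/27) n⁵ of the
-- 5-tuples span three edges. No error term arises, since the inequality holds for every assignment of truth
-- values to the 20 triples of positions. Being invariant under permutations of the positions, it only has to
-- be evaluated for assignments that are lexicographically minimal under transpositions of neighbours.
module Submission where

open import Defs
open import Data.Product using (_×_)
open import Data.Integer using (+_)
open import Data.Rational using (_/_)

open import Data.Bool using (Bool; true; false; _∧_; _∨_; not; if_then_else_; T)
import Data.Bool.Properties as Bool
open import Data.Fin as Fin using (Fin; zero; suc; toℕ; _<_; _<?_)
import Data.Fin.Properties as Fin
open import Data.Integer as ℤ using (ℤ; -[1+_]; _+_; _*_; _-_; -_; _≤_; _≤ᵇ_; 0ℤ; 1ℤ; +≤+)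
import Data.Integer.Properties as ℤ
open import Data.Integer.Properties hiding (_<?_; <-asym)
open import Data.Integer.Tactic.RingSolver using (solve-∀)
open import Data.List using (List; []; _∷_; _++_; map; length; filter; allFin; tabulate)
open import Data.List.Properties using (length-tabulate; length-++; length-map)
open import Data.List.Relation.Unary.All as All using (All; []; _∷_)
import Data.List.Relation.Unary.All.Properties as All
open import Data.List.Relation.Unary.AllPairs using (AllPairs; []; _∷_)
import Data.List.Relation.Unary.AllPairs.Properties as AllPairs
open import Data.Nat as ℕ using (ℕ; zero; suc; _!; _^_; _≡ᵇ_; z≤n; s≤s)
open import Data.Nat.Combinatorics using (_C_; nCk+nC[k+1]≡[n+1]C[k+1])
open import Data.Nat.Coprimality using (Coprime)
open import Data.Nat.Induction using (<-wellFounded)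
open import Data.Nat.ListAction using (sum)
import Data.Nat.Properties as ℕ
import Data.Nat.Tactic.RingSolver as ℕ-Solver
open import Data.Product using (Σ; _,_; proj₁; proj₂)
open import Data.Rational as ℚ using (ℚ; mkℚ; Positive; toℚᵘ)
import Data.Rational.Properties as ℚ
open import Data.Rational.Unnormalised as ℚᵘ using (mkℚᵘ; *≤*)
import Data.Rational.Unnormalised.Properties as ℚᵘ
open import Data.Sum using (_⊎_; inj₁; inj₂)
open import Data.Unit using (tt)
open import Data.Vec as Vec using (Vec; []; _∷_; lookup; toList)
open import Function using (_∘_; id)
open import Induction.WellFounded using (Acc; acc)
open import Relation.Binary.PropositionalEquality hiding ([_])
open import Relation.Nullary using (does; yes)
open import Relation.Nullary.Decidable using (⌊_⌋; dec-true; dec-false; toWitness)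
open import Relation.Unary using (Decidable)

private variable
  A B : Set
  k r i j : ℕ

-- Sums over tuples

∑ : List A → (A → ℤ) → ℤ
∑ []       f = 0ℤ
∑ (x ∷ xs) f = f x + ∑ xs f

∑-cong : (xs : List A) {f g : A → ℤ} → (∀ x → f x ≡ g x) → ∑ xs f ≡ ∑ xs g
∑-cong []       eq = refl
∑-cong (x ∷ xs) eq = cong₂ _+_ (eq x) (∑-cong xs eq)

∑-mono : (xs : List A) {f g : A → ℤ} → (∀ x → f x ≤ g x) → ∑ xs f ≤ ∑ xs g
∑-mono []       le = ≤-refl
∑-mono (x ∷ xs) le = +-mono-≤ (le x) (∑-mono xs le)

∑-zero : (xs : List A) → ∑ xs (λ _ → 0ℤ) ≡ 0ℤ
∑-zero []       = refl
∑-zero (x ∷ xs) = trans (+-identityˡ _) (∑-zero xs)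

interchange : ∀ a b c d → (a + b) + (c + d) ≡ (a + c) + (b + d)
interchange = solve-∀

-- The shapes of sum met in `parts-sym`, where the mixed terms b and c trade places. In `swapʳ` and
-- `swapˡ` one part has a single slot, so the term with both neighbours in that part is absent.
swapʳ : ∀ {a a'} → a ≡ a' → ∀ b c → (a + b) + c ≡ (a' + c) + b
swapʳ {a} refl b c = trans (+-assoc a b c) (trans (cong (_+_ a) (+-comm b c)) (sym (+-assoc a c b)))

swapˡ : ∀ b c {a a'} → a ≡ a' → b + (c + a) ≡ c + (b + a')
swapˡ b c {a} refl = trans (sym (+-assoc b c a)) (trans (cong (_+ a) (+-comm b c)) (+-assoc c b a))

swapᵐ : ∀ {a a'} → a ≡ a' → ∀ b c {d d'} → d ≡ d' → (a + b) + (c + d) ≡ (a' + c) + (b + d')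
swapᵐ {a} refl b c {d} refl = interchange a b c d

∑-+ : (xs : List A) (f g : A → ℤ) → ∑ xs (λ x → f x + g x) ≡ ∑ xs f + ∑ xs g
∑-+ []       f g = refl
∑-+ (x ∷ xs) f g = trans (cong (_+_ (f x + g x)) (∑-+ xs f g)) (interchange (f x) (g x) (∑ xs f) (∑ xs g))

∑-* : (xs : List A) (c : ℤ) (f : A → ℤ) → ∑ xs (λ x → c * f x) ≡ c * ∑ xs f
∑-* []       c f = sym (*-zeroʳ c)
∑-* (x ∷ xs) c f = trans (cong (_+_ (c * f x)) (∑-* xs c f)) (sym (*-distribˡ-+ c (f x) (∑ xs f)))

∑-comm : (xs : List A) (ys : List B) (f : A → B → ℤ) →
         ∑ xs (λ x → ∑ ys (f x)) ≡ ∑ ys (λ y → ∑ xs (λ x → f x y))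
∑-comm []       ys f = sym (∑-zero ys)
∑-comm (x ∷ xs) ys f = trans (cong (_+_ (∑ ys (f x))) (∑-comm xs ys f)) (sym (∑-+ ys (f x) _))

0≤+ : ∀ {a b} → 0ℤ ≤ a → 0ℤ ≤ b → 0ℤ ≤ a + b
0≤+ p q = +-mono-≤ p q

∑-nonneg : (xs : List A) {f : A → ℤ} → (∀ x → 0ℤ ≤ f x) → 0ℤ ≤ ∑ xs f
∑-nonneg []       p = ≤-refl
∑-nonneg (x ∷ xs) p = 0≤+ (p x) (∑-nonneg xs p)

Σᵗ : List A → ∀ k → (Vec A k → ℤ) → ℤ
Σᵗ V zero    g = g []
Σᵗ V (suc k) g = ∑ V λ a → Σᵗ V k λ l → g (a ∷ l)

module _ (V : List A) where

  Σᵗ-cong : ∀ k {f g : Vec A k → ℤ} → (∀ l → f l ≡ g l) → Σᵗ V k f ≡ Σᵗ V k g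
  Σᵗ-cong zero    eq = eq []
  Σᵗ-cong (suc k) eq = ∑-cong V λ a → Σᵗ-cong k λ l → eq (a ∷ l)

  Σᵗ-mono : ∀ k {f g : Vec A k → ℤ} → (∀ l → f l ≤ g l) → Σᵗ V k f ≤ Σᵗ V k g
  Σᵗ-mono zero    le = le []
  Σᵗ-mono (suc k) le = ∑-mono V λ a → Σᵗ-mono k λ l → le (a ∷ l)

  Σᵗ-zero : ∀ k → Σᵗ V k (λ _ → 0ℤ) ≡ 0ℤ
  Σᵗ-zero zero    = refl
  Σᵗ-zero (suc k) = trans (∑-cong V λ _ → Σᵗ-zero k) (∑-zero V)

  Σᵗ-nonneg : ∀ k {f : Vec A k → ℤ} → (∀ l → 0ℤ ≤ f l) → 0ℤ ≤ Σᵗ V k f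
  Σᵗ-nonneg zero    p = p []
  Σᵗ-nonneg (suc k) p = ∑-nonneg V λ a → Σᵗ-nonneg k λ l → p (a ∷ l)

  Σᵗ-+ : ∀ k (f g : Vec A k → ℤ) → Σᵗ V k (λ l → f l + g l) ≡ Σᵗ V k f + Σᵗ V k g
  Σᵗ-+ zero    f g = refl
  Σᵗ-+ (suc k) f g = trans (∑-cong V λ a → Σᵗ-+ k _ _) (∑-+ V _ _)

  Σᵗ-* : ∀ k c (f : Vec A k → ℤ) → Σᵗ V k (λ l → c * f l) ≡ c * Σᵗ V k f
  Σᵗ-* zero    c f = refl
  Σᵗ-* (suc k) c f = trans (∑-cong V λ a → Σᵗ-* k c _) (∑-* V c _)

  Σᵗ-∑ : ∀ k (xs : List B) (f : Vec A k → B → ℤ) →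
         Σᵗ V k (λ l → ∑ xs (f l)) ≡ ∑ xs (λ b → Σᵗ V k (λ l → f l b))
  Σᵗ-∑ zero    xs f = refl
  Σᵗ-∑ (suc k) xs f = trans (∑-cong V λ a → Σᵗ-∑ k xs _) (∑-comm V xs _)

-- The sum of F l m over all ways to split a k-tuple into an i-subtuple l and the complementary j-subtuple m.
parts : ∀ k i j → (Vec A i → Vec A j → ℤ) → Vec A k → ℤ
parts zero    zero    zero    F []       = F [] []
parts zero    _       _       F []       = 0ℤ
parts (suc k) zero    zero    F (x ∷ xs) = 0ℤ
parts (suc k) (suc i) zero    F (x ∷ xs) = parts k i zero (λ l m → F (x ∷ l) m) xs
parts (suc k) zero    (suc j) F (x ∷ xs) = parts k zero j (λ l m → F l (x ∷ m)) xs
parts (suc k) (suc i) (suc j) F (x ∷ xs) =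
  parts k i (suc j) (λ l m → F (x ∷ l) m) xs + parts k (suc i) j (λ l m → F l (x ∷ m)) xs

parts-cong : ∀ k i j {F G : Vec A i → Vec A j → ℤ} → (∀ l m → F l m ≡ G l m) →
             ∀ xs → parts k i j F xs ≡ parts k i j G xs
parts-cong zero    zero    zero    eq []       = eq [] []
parts-cong zero    zero    (suc j) eq []       = refl
parts-cong zero    (suc i) j       eq []       = refl
parts-cong (suc k) zero    zero    eq (x ∷ xs) = refl
parts-cong (suc k) (suc i) zero    eq (x ∷ xs) = parts-cong k i zero (λ l m → eq (x ∷ l) m) xs
parts-cong (suc k) zero    (suc j) eq (x ∷ xs) = parts-cong k zero j (λ l m → eq l (x ∷ m)) xs
parts-cong (suc k) (suc i) (suc j) eq (x ∷ xs) =
  cong₂ _+_ (parts-cong k i (suc j) (λ l m → eq (x ∷ l) m) xs) (parts-cong k (suc i) j (λ l m → eq l (x ∷ m)) xs)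

-- The binomial coefficient of k over i if i + j = k, and 0 otherwise. It copies the recursion of
-- `parts`, so that the next induction runs clause by clause.
choices : ℕ → ℕ → ℕ → ℕ
choices zero    zero    zero    = 1
choices zero    _       _       = 0
choices (suc k) zero    zero    = 0
choices (suc k) (suc i) zero    = choices k i zero
choices (suc k) zero    (suc j) = choices k zero j
choices (suc k) (suc i) (suc j) = choices k i (suc j) ℕ.+ choices k (suc i) j

-- In a sum over all k-tuples a splitting merely renames the positions, so l and m range over all
-- tuples independently. This is exact because repetitions are allowed.
Σᵗ-parts : (V : List A) → ∀ k i j (F : Vec A i → Vec A j → ℤ) →
  Σᵗ V k (parts k i j F) ≡ + choices k i j * Σᵗ V i (λ l → Σᵗ V j (F l))
Σᵗ-parts V zero zero zero F = sym (*-identityˡ _)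
Σᵗ-parts V zero zero (suc j) F = refl
Σᵗ-parts V zero (suc i) j F = refl
Σᵗ-parts V (suc k) zero zero F = Σᵗ-zero V (suc k)
Σᵗ-parts V (suc k) (suc i) zero F =
  trans (∑-cong V λ a → Σᵗ-parts V k i zero _)
        (∑-* V (+ choices k i zero) λ a → Σᵗ V i λ l → F (a ∷ l) [])
Σᵗ-parts V (suc k) zero (suc j) F =
  trans (∑-cong V λ a → Σᵗ-parts V k zero j _)
        (∑-* V (+ choices k zero j) λ a → Σᵗ V j λ m → F [] (a ∷ m))
Σᵗ-parts V (suc k) (suc i) (suc j) F = begin
  ∑ V (λ a → Σᵗ V k (λ xs → parts k i (suc j) (λ l m → F (a ∷ l) m) xs + parts k (suc i) j (λ l m → F l (a ∷ m)) xs))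
    ≡⟨ ∑-cong V (λ a → Σᵗ-+ V k _ _) ⟩
  ∑ V (λ a → Σᵗ V k (parts k i (suc j) (λ l m → F (a ∷ l) m)) + Σᵗ V k (parts k (suc i) j (λ l m → F l (a ∷ m))))
    ≡⟨ ∑-+ V _ _ ⟩
  ∑ V (λ a → Σᵗ V k (parts k i (suc j) (λ l m → F (a ∷ l) m))) + ∑ V (λ a → Σᵗ V k (parts k (suc i) j (λ l m → F l (a ∷ m))))
    ≡⟨ cong₂ _+_ (trans (∑-cong V λ a → Σᵗ-parts V k i (suc j) _)
                        (∑-* V (+ p) λ a → Σᵗ V i λ l → Σᵗ V (suc j) (F (a ∷ l))))
                 (trans (∑-cong V λ a → Σᵗ-parts V k (suc i) j _)
                        (∑-* V (+ q) λ a → Σᵗ V (suc i) λ l → Σᵗ V j λ m → F l (a ∷ m))) ⟩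
  + p * S + + q * ∑ V (λ a → Σᵗ V (suc i) (λ l → Σᵗ V j (λ m → F l (a ∷ m))))
    ≡⟨ cong (λ z → + p * S + + q * z) (Σᵗ-∑ V (suc i) V (λ l a → Σᵗ V j λ m → F l (a ∷ m))) ⟨
  + p * S + + q * S
    ≡⟨ *-distribʳ-+ S (+ p) (+ q) ⟨
  (+ p + + q) * S ∎
  where
  open ≡-Reasoning
  p = choices k i (suc j)
  q = choices k (suc i) j
  S = Σᵗ V (suc i) (λ l → Σᵗ V (suc j) (F l))

-- The transposition of positions s and s + 1, or the identity once these run past the end, so that
-- `Sym` can quantify over all s. Such transpositions generate all permutations.
sw : ℕ → Vec A k → Vec A k
sw s       []          = []
sw zero    (a ∷ [])    = a ∷ []
sw zero    (a ∷ b ∷ l) = b ∷ a ∷ l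
sw (suc s) (a ∷ l)     = a ∷ sw s l

sw₁ : ∀ s (p : Vec A 1) → sw s p ≡ p
sw₁ zero    (a ∷ []) = refl
sw₁ (suc s) (a ∷ []) = refl

Sym : (Vec A k → ℤ) → Set
Sym F = ∀ s l → F (sw s l) ≡ F l

-- If both neighbours fall into one part, the symmetry of F in that part applies; if they are
-- separated, the transposition exchanges the two ways of separating them.
parts-sym : ∀ k i j (F : Vec A i → Vec A j → ℤ) →
  (∀ m → Sym (λ l → F l m)) → (∀ l → Sym (F l)) → Sym (parts k i j F)
parts-sym zero i j F p q s [] = refl
parts-sym (suc k) zero zero F p q zero    (x ∷ []) = refl
parts-sym (suc k) zero zero F p q zero    (x ∷ y ∷ l) = refl
parts-sym (suc k) zero zero F p q (suc s) (x ∷ l) = refl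
parts-sym (suc k) (suc i) zero F p q (suc s) (x ∷ l) =
  parts-sym k i zero _ (λ m t l' → p m (suc t) (x ∷ l')) (λ l' → q (x ∷ l')) s l
parts-sym (suc k) zero (suc j) F p q (suc s) (x ∷ l) =
  parts-sym k zero j _ (λ m → p (x ∷ m)) (λ l' t m → q l' (suc t) (x ∷ m)) s l
parts-sym (suc k) (suc i) (suc j) F p q (suc s) (x ∷ l) = cong₂ _+_
  (parts-sym k i (suc j) _ (λ m t l' → p m (suc t) (x ∷ l')) (λ l' → q (x ∷ l')) s l)
  (parts-sym k (suc i) j _ (λ m → p (x ∷ m)) (λ l' t m → q l' (suc t) (x ∷ m)) s l)
parts-sym (suc k) (suc i) zero    F p q zero (x ∷ []) = refl
parts-sym (suc k) zero    (suc j) F p q zero (x ∷ []) = refl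
parts-sym (suc k) (suc i) (suc j) F p q zero (x ∷ []) = refl
parts-sym (suc (suc k)) (suc zero)    zero F p q zero (x ∷ y ∷ l) = refl
parts-sym (suc (suc k)) (suc (suc i)) zero F p q zero (x ∷ y ∷ l) =
  parts-cong k i zero (λ l' m → p m 0 (x ∷ y ∷ l')) l
parts-sym (suc (suc k)) zero (suc zero)    F p q zero (x ∷ y ∷ l) = refl
parts-sym (suc (suc k)) zero (suc (suc j)) F p q zero (x ∷ y ∷ l) =
  parts-cong k zero j (λ l' m → q l' 0 (x ∷ y ∷ m)) l
parts-sym (suc (suc k)) (suc zero) (suc zero) F p q zero (x ∷ y ∷ l) =
  +-comm (parts k 0 0 (λ l' m → F (y ∷ l') (x ∷ m)) l) _
parts-sym (suc (suc k)) (suc (suc i)) (suc zero) F p q zero (x ∷ y ∷ l) =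
  swapʳ (parts-cong k i 1 (λ l' m → p m 0 (x ∷ y ∷ l')) l) (mixed y x) (mixed x y)
  where mixed = λ u v → parts k (suc i) 0 (λ l' m → F (u ∷ l') (v ∷ m)) l
parts-sym (suc (suc k)) (suc zero) (suc (suc j)) F p q zero (x ∷ y ∷ l) =
  swapˡ (mixed y x) (mixed x y) (parts-cong k 1 j (λ l' m → q l' 0 (x ∷ y ∷ m)) l)
  where mixed = λ u v → parts k 0 (suc j) (λ l' m → F (u ∷ l') (v ∷ m)) l
parts-sym (suc (suc k)) (suc (suc i)) (suc (suc j)) F p q zero (x ∷ y ∷ l) =
  swapᵐ (parts-cong k i (suc (suc j)) (λ l' m → p m 0 (x ∷ y ∷ l')) l) (mixed y x) (mixed x y)
        (parts-cong k (suc (suc i)) j (λ l' m → q l' 0 (x ∷ y ∷ m)) l)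
  where mixed = λ u v → parts k (suc i) (suc j) (λ l' m → F (u ∷ l') (v ∷ m)) l

-- From subsets to tuples with repetitions; edge counts

bit : Bool → ℕ
bit false = 0
bit true  = 1

β : Bool → ℤ
β b = + bit b

∑-++ : (xs ys : List A) (f : A → ℤ) → ∑ (xs ++ ys) f ≡ ∑ xs f + ∑ ys f
∑-++ []       ys f = sym (+-identityˡ _)
∑-++ (x ∷ xs) ys f = trans (cong (_+_ (f x)) (∑-++ xs ys f)) (sym (+-assoc (f x) _ _))

∑-map : (h : A → B) (xs : List A) (f : B → ℤ) → ∑ (map h xs) f ≡ ∑ xs (f ∘ h)
∑-map h []       f = refl
∑-map h (x ∷ xs) f = cong (_+_ (f (h x))) (∑-map h xs f)

∑-filter : {P : A → Set} (P? : Decidable P) (xs : List A) →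
           + length (filter P? xs) ≡ ∑ xs (λ x → β (does (P? x)))
∑-filter P? [] = refl
∑-filter P? (x ∷ xs) with does (P? x)
... | true  = cong (_+_ 1ℤ) (∑-filter P? xs)
... | false = trans (∑-filter P? xs) (sym (+-identityˡ _))

Σᵗ-weaken : (x : A) (xs : List A) → ∀ r {h : Vec A r → ℤ} → (∀ l → 0ℤ ≤ h l) → Σᵗ xs r h ≤ Σᵗ (x ∷ xs) r h
Σᵗ-weaken x xs zero    0≤h = ≤-refl
Σᵗ-weaken x xs (suc r) {h} 0≤h = begin
  Σᵗ xs (suc r) h                             ≡⟨ +-identityˡ _ ⟨
  0ℤ + Σᵗ xs (suc r) h                        ≤⟨ +-mono-≤ (Σᵗ-nonneg (x ∷ xs) r λ l → 0≤h (x ∷ l))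
                                                 (∑-mono xs λ a → Σᵗ-weaken x xs r λ l → 0≤h (a ∷ l)) ⟩
  Σᵗ (x ∷ xs) (suc r) h                       ∎
  where open ≤-Reasoning

-- Only the tuples with at most one entry equal to x are kept.
Σᵗ-insert : (x : A) (xs : List A) → ∀ r (h : Vec A (suc r) → ℤ) → (∀ l → 0ℤ ≤ h l) → Sym h →
  + suc r * Σᵗ xs r (λ l → h (x ∷ l)) + Σᵗ xs (suc r) h ≤ Σᵗ (x ∷ xs) (suc r) h
Σᵗ-insert x xs zero    h 0≤h sy = ≤-reflexive (cong (_+ ∑ xs _) (*-identityˡ (h (x ∷ []))))
Σᵗ-insert x xs (suc r) h 0≤h sy = begin
  + suc (suc r) * S + R
    ≡⟨ lemma (+ suc r) S R ⟩
  S + (+ suc r * S + R)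
    ≡⟨ cong (λ s → S + (+ suc r * s + R)) (∑-cong xs λ a → Σᵗ-cong xs r λ l → sym (sy 0 (x ∷ a ∷ l))) ⟩
  S + (+ suc r * ∑ xs (λ a → Σᵗ xs r λ l → h (a ∷ x ∷ l)) + R)
    ≡⟨ cong (λ s → S + (s + R)) (∑-* xs (+ suc r) (λ a → Σᵗ xs r λ l → h (a ∷ x ∷ l))) ⟨
  S + (∑ xs (λ a → + suc r * Σᵗ xs r λ l → h (a ∷ x ∷ l)) + R)
    ≡⟨ cong (_+_ S) (∑-+ xs (λ a → + suc r * Σᵗ xs r λ l → h (a ∷ x ∷ l)) (λ a → Σᵗ xs (suc r) λ l → h (a ∷ l))) ⟨
  S + ∑ xs (λ a → + suc r * (Σᵗ xs r λ l → h (a ∷ x ∷ l)) + Σᵗ xs (suc r) λ l → h (a ∷ l))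
    ≤⟨ +-mono-≤ (Σᵗ-weaken x xs (suc r) λ l → 0≤h (x ∷ l))
                (∑-mono xs λ a → Σᵗ-insert x xs r (λ l → h (a ∷ l)) (λ l → 0≤h (a ∷ l)) (λ s l → sy (suc s) (a ∷ l))) ⟩
  Σᵗ (x ∷ xs) (suc (suc r)) h ∎
  where
  open ≤-Reasoning
  S = Σᵗ xs (suc r) (λ l → h (x ∷ l))
  R = Σᵗ xs (suc (suc r)) h
  lemma : ∀ n s t → (1ℤ + n) * s + t ≡ s + (n * s + t)
  lemma = solve-∀

-- Each r-subset accounts for r! of the r-tuples, and tuples with repetitions add nonnegative terms.
-- In the induction the factor `suc r` counts the places that x can take.
choose-≤ : ∀ r (xs : List A) (g : List A → ℤ) → (∀ l → 0ℤ ≤ g l) → Sym {k = r} (g ∘ toList) →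
           + (r !) * ∑ (choose r xs) g ≤ Σᵗ xs r (g ∘ toList)
choose-≤ zero    xs       g 0≤g sy = ≤-reflexive (trans (*-identityˡ _) (+-identityʳ (g [])))
choose-≤ (suc r) []       g 0≤g sy = ≤-reflexive (*-zeroʳ (+ (suc r !)))
choose-≤ (suc r) (x ∷ xs) g 0≤g sy = begin
  + (suc r !) * ∑ (map (x ∷_) (choose r xs) ++ choose (suc r) xs) g
    ≡⟨ cong (_*_ (+ (suc r !))) (trans (∑-++ (map (x ∷_) (choose r xs)) _ g) (cong (_+ ∑ (choose (suc r) xs) g) (∑-map (x ∷_) (choose r xs) g))) ⟩
  + (suc r !) * (p + q)
    ≡⟨ *-distribˡ-+ (+ (suc r !)) p q ⟩
  + (suc r !) * p + + (suc r !) * q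
    ≡⟨ cong (_+ + (suc r !) * q) (trans (cong (_* p) (pos-* (suc r) (r !))) (*-assoc (+ suc r) (+ (r !)) p)) ⟩
  + suc r * (+ (r !) * p) + + (suc r !) * q
    ≤⟨ +-mono-≤ (*-monoˡ-≤-nonNeg (+ suc r) (choose-≤ r xs (g ∘ (x ∷_)) (λ l → 0≤g (x ∷ l)) (λ s l → sy (suc s) (x ∷ l))))
                (choose-≤ (suc r) xs g 0≤g sy) ⟩
  + suc r * Σᵗ xs r (λ l → g (x ∷ toList l)) + Σᵗ xs (suc r) (g ∘ toList)
    ≤⟨ Σᵗ-insert x xs r (g ∘ toList) (λ l → 0≤g (toList l)) sy ⟩
  Σᵗ (x ∷ xs) (suc r) (g ∘ toList) ∎
  where
  open ≤-Reasoning
  p = ∑ (choose r xs) (g ∘ (x ∷_))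
  q = ∑ (choose (suc r) xs) g

-- A sum of bits reduces to an explicit expression in the edge indicators, unlike the length of a
-- filtered list.
edges : ∀ {n} → Graph3 n → List (Fin n) → ℕ
edges G S = sum (map (bit ∘ isEdge G) (choose 3 S))

edgesIn≡edges : ∀ {n} (G : Graph3 n) S → edgesIn G S ≡ edges G S
edgesIn≡edges G S = go (choose 3 S)
  where
  go : ∀ Ts → length (filter (λ T → isEdge G T Bool.≟ true) Ts) ≡ sum (map (bit ∘ isEdge G) Ts)
  go [] = refl
  go (T ∷ Ts) with isEdge G T
  ... | true  = cong suc (go Ts)
  ... | false = go Ts

record Symmetric {n} (e : Graph3 n) : Set where
  field
    swap₁₂ : ∀ a b c → e a b c ≡ e b a c
    swap₂₃ : ∀ a b c → e a b c ≡ e a c b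

edgeᵛ : ∀ {n} → Graph3 n → Vec (Fin n) 3 → ℤ
edgeᵛ e (a ∷ b ∷ c ∷ []) = β (e a b c)

-- Writing the ten triples as the splittings 5 = 3 + 2 makes the symmetry of the count an instance
-- of `parts-sym`.
edges-parts : ∀ {n} (e : Graph3 n) (l : Vec (Fin n) 5) → + edges e (toList l) ≡ parts 5 3 2 (λ T _ → edgeᵛ e T) l
edges-parts e (a ∷ b ∷ c ∷ d ∷ x ∷ []) =
  lemma (β (e a b c)) (β (e a b d)) (β (e a b x)) (β (e a c d)) (β (e a c x))
        (β (e a d x)) (β (e b c d)) (β (e b c x)) (β (e b d x)) (β (e c d x))
  where
  lemma : ∀ p q r s t u v w y z → p + (q + (r + (s + (t + (u + (v + (w + (y + (z + 0ℤ)))))))))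
          ≡ ((p + (q + r)) + ((s + t) + u)) + (((v + w) + y) + z)
  lemma = solve-∀

module _ {n : ℕ} {e : Graph3 n} (e-sym : Symmetric e) where
  open Symmetric e-sym

  edgeᵛ-sym : Sym (edgeᵛ e)
  edgeᵛ-sym 0 (a ∷ b ∷ c ∷ []) = cong β (swap₁₂ b a c)
  edgeᵛ-sym 1 (a ∷ b ∷ c ∷ []) = cong β (swap₂₃ a c b)
  edgeᵛ-sym 2 (a ∷ b ∷ c ∷ []) = refl
  edgeᵛ-sym (suc (suc (suc s))) (a ∷ b ∷ c ∷ []) = refl

  edges-sym : ∀ s (l : Vec (Fin n) 5) → edges e (toList (sw s l)) ≡ edges e (toList l)
  edges-sym s l = +-injective (trans (edges-parts e (sw s l)) (trans
    (parts-sym 5 3 2 (λ T _ → edgeᵛ e T) (λ _ → edgeᵛ-sym) (λ _ _ _ → refl) s l) (sym (edges-parts e l))))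

-- The sum-of-squares certificate

∧-true : ∀ a {b} → a ∧ b ≡ true → a ≡ true × b ≡ true
∧-true true p = refl , p

-- A quantifier over bit vectors that computes, so that a finite statement can be proved by `refl`.
all : ∀ n → (Vec Bool n → Bool) → Bool
all zero    P = P []
all (suc n) P = all n (λ v → P (false ∷ v)) ∧ all n (λ v → P (true ∷ v))

all-true : ∀ n {P} → all n P ≡ true → ∀ v → P v ≡ true
all-true zero    p []          = p
all-true (suc n) {P} p (false ∷ v) = all-true n (proj₁ (∧-true (all n λ v → P (false ∷ v)) p)) v
all-true (suc n) {P} p (true  ∷ v) = all-true n (proj₂ (∧-true (all n λ v → P (false ∷ v)) p)) v

-- Four vertices a, b, c, d have the trace (abc, abd, acd, bcd) of edge indicators, and a further vertex u
-- has the link (abu, acu, adu, bcu, bdu, cdu) over them; the vertex a is distinguished.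
Trace Link : Set
Trace = Vec Bool 4
Link  = Vec Bool 6

-- A form contributes weight · (Σᵤ value (link u))² ≥ 0; an alternating one changes sign under
-- transpositions of b, c, d.
record Form : Set where
  constructor form
  field
    alternating : Bool
    weight      : ℕ
    value       : Link → ℤ
open Form

gram : List Form → Link → Link → ℤ
gram []       f g = 0ℤ
gram (φ ∷ φs) f g = + weight φ * (value φ f * value φ g) + gram φs f g

-- The link of u is read as a graph on a, b, c, d. These counts of edges and of pairs of edges, by
-- position relative to a, are invariant under permutations of b, c, d.
far near farPairs nearPairs adjacent opposite : Link → ℤ
far       (ab ∷ ac ∷ ad ∷ bc ∷ bd ∷ cd ∷ []) = β bc + β bd + β cd
near      (ab ∷ ac ∷ ad ∷ bc ∷ bd ∷ cd ∷ []) = β ab + β ac + β ad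
farPairs  (ab ∷ ac ∷ ad ∷ bc ∷ bd ∷ cd ∷ []) = β (bc ∧ bd) + β (bc ∧ cd) + β (bd ∧ cd)
nearPairs (ab ∷ ac ∷ ad ∷ bc ∷ bd ∷ cd ∷ []) = β (ab ∧ ac) + β (ab ∧ ad) + β (ac ∧ ad)
adjacent  (ab ∷ ac ∷ ad ∷ bc ∷ bd ∷ cd ∷ []) =
  β (ab ∧ bc) + β (ab ∧ bd) + β (ac ∧ bc) + β (ac ∧ cd) + β (ad ∧ bd) + β (ad ∧ cd)
opposite  (ab ∷ ac ∷ ad ∷ bc ∷ bd ∷ cd ∷ []) = β (ab ∧ cd) + β (ac ∧ bd) + β (ad ∧ bc)

-- For a trace with the single edge abc, the three δ are fixed by exchanging b and c and sum to zero
-- when a, b, c are rotated: they lie in copies of the standard representation. For the trace abc,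
-- abd, the spine is the common pair ab.
δ₀ δ₁ δ₂ sides spine rung : Link → ℤ
δ₀    (ab ∷ ac ∷ ad ∷ bc ∷ bd ∷ cd ∷ []) = β ab + β ac - + 2 * β bc
δ₁    (ab ∷ ac ∷ ad ∷ bc ∷ bd ∷ cd ∷ []) = + 2 * β ad - β bd - β cd
δ₂    (ab ∷ ac ∷ ad ∷ bc ∷ bd ∷ cd ∷ []) = β (ab ∧ bd) + β (ac ∧ cd) - β (bc ∧ bd) - β (bc ∧ cd)
spine (ab ∷ ac ∷ ad ∷ bc ∷ bd ∷ cd ∷ []) = β ab
rung  (ab ∷ ac ∷ ad ∷ bc ∷ bd ∷ cd ∷ []) = β cd
sides (ab ∷ ac ∷ ad ∷ bc ∷ bd ∷ cd ∷ []) = β ac + β ad + β bc + β bd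

-- A rational solution of the semidefinite program, scaled by 64800000. In the extremal configuration every
-- pair of vertices has codegree n / 3, and all the forms below sum to zero over u.
empty apex end base centre : List Form
empty  = form false 32400000 (λ f → far f + near f - + 2) ∷ []
apex   =
  form false 84375     (λ f → + 73 * near f - + 67 * far f + + 72 * farPairs f - + 16 * adjacent f - + 30) ∷
  form false 862500    (λ f → + 2 * near f + + 8 * far f - + 3 * adjacent f - + 10) ∷
  form false 1265625   (λ f → + 4 * adjacent f - + 9 * (far f + near f - + 2)) ∷
  form false 1350000   (λ f → far f + near f - + 2) ∷
  form true  324000000 (λ { (ab ∷ ac ∷ ad ∷ bc ∷ bd ∷ cd ∷ []) →
    β (ac ∧ bc) - β (ab ∧ bc) + (β (ab ∧ bd) - β (ad ∧ bd)) + (β (ad ∧ cd) - β (ac ∧ cd)) }) ∷ []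
end    =
  form false 67500     (λ f → + 40 * δ₀ f + + 13 * δ₁ f - + 5 * δ₂ f) ∷
  form false 64192500  (λ f → δ₁ f - δ₂ f) ∷
  form false 43200000  δ₂ ∷ []
base   =
  form false 22500     (λ f → + 32 * spine f + + 26 * rung f - + 37 * sides f + + 30) ∷
  form false 172656    (λ f → + 51 * rung f - + 24 * spine f - + 6 * sides f - + 1) ∷ []
centre =
  form false 140625    (λ f → + 104 * near f + + 56 * far f - + 32 * nearPairs f - + 17 * opposite f - + 40 * adjacent f - + 128) ∷
  form false 1437500   (λ f → + 6 * near f + + 12 * far f - + 6 * nearPairs f + opposite f - + 6 * adjacent f - + 12) ∷
  form false 4320000   (λ f → + 3 * (nearPairs f - near f) + + 8 * opposite f - + 3 * adjacent f) ∷
  form false 3600000   (λ f → + 2 * (nearPairs f - near f) + adjacent f) ∷ []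

bc↔ cd↔ : Link → Link
bc↔ (ab ∷ ac ∷ ad ∷ bc ∷ bd ∷ cd ∷ []) = ac ∷ ab ∷ ad ∷ bc ∷ cd ∷ bd ∷ []
cd↔ (ab ∷ ac ∷ ad ∷ bc ∷ bd ∷ cd ∷ []) = ab ∷ ad ∷ ac ∷ bd ∷ bc ∷ cd ∷ []

bc↔ᵗ cd↔ᵗ : Trace → Trace
bc↔ᵗ (abc ∷ abd ∷ acd ∷ bcd ∷ []) = abc ∷ acd ∷ abd ∷ bcd ∷ []
cd↔ᵗ (abc ∷ abd ∷ acd ∷ bcd ∷ []) = abd ∷ abc ∷ acd ∷ bcd ∷ []

relabel : (Link → Link) → List Form → List Form
relabel τ = map λ φ → record φ { value = value φ ∘ τ }

-- `end` applies when a lies on the only edge, `apex` when it lies off it, `centre` when it is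
-- common to three edges. Relabelling moves the edges to their standard place, which makes the
-- family equivariant under permutations of b, c, d.
forms : Trace → List Form
forms (false ∷ false ∷ false ∷ false ∷ []) = empty
forms (false ∷ false ∷ false ∷ true  ∷ []) = apex
forms (true  ∷ false ∷ false ∷ false ∷ []) = end
forms (false ∷ true  ∷ false ∷ false ∷ []) = relabel cd↔ end
forms (false ∷ false ∷ true  ∷ false ∷ []) = relabel (cd↔ ∘ bc↔) end
forms (true  ∷ true  ∷ false ∷ false ∷ []) = base
forms (true  ∷ false ∷ true  ∷ false ∷ []) = relabel bc↔ base
forms (false ∷ true  ∷ true  ∷ false ∷ []) = relabel (bc↔ ∘ cd↔) base
forms (true  ∷ true  ∷ true  ∷ false ∷ []) = centre
forms _                                    = []

signed : Bool → ℤ → ℤ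
signed false i = i
signed true  i = - i

signed-* : ∀ b i j → signed b i * signed b j ≡ i * j
signed-* false i j = refl
signed-* true  i j = lemma i j
  where
  lemma : ∀ i j → - i * - j ≡ i * j
  lemma = solve-∀

-- Comparing the forms on single links settles their products on pairs of links, since the sign of
-- an alternating form occurs twice there. This leaves 2¹⁰ cases to check instead of 2¹⁶.
agree : List Form → List Form → Link → Link → Bool
agree []       []       f f' = true
agree (φ ∷ φs) (ψ ∷ ψs) f f' =
  ((weight φ ≡ᵇ weight ψ) ∧ ⌊ value ψ f' ≟ signed (alternating φ) (value φ f) ⌋) ∧ agree φs ψs f f'
agree _        _        f f' = false

≟-true : ∀ i j → ⌊ i ≟ j ⌋ ≡ true → i ≡ j
≟-true i j p with yes q ← i ≟ j = q

≡ᵇ-true : ∀ m n → (m ≡ᵇ n) ≡ true → m ≡ n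
≡ᵇ-true zero    zero    p = refl
≡ᵇ-true (suc m) (suc n) p = cong suc (≡ᵇ-true m n p)

gram-agree : ∀ φs ψs {f f' g g'} → agree φs ψs f f' ≡ true → agree φs ψs g g' ≡ true →
             gram ψs f' g' ≡ gram φs f g
gram-agree []       []       p q = refl
gram-agree (φ ∷ φs) (ψ ∷ ψs) {f} {f'} {g} {g'} p q
  with p₁ , p₂ ← ∧-true ((weight φ ≡ᵇ weight ψ) ∧ ⌊ value ψ f' ≟ signed (alternating φ) (value φ f) ⌋) p
     | q₁ , q₂ ← ∧-true ((weight φ ≡ᵇ weight ψ) ∧ ⌊ value ψ g' ≟ signed (alternating φ) (value φ g) ⌋) q
  with w , vf ← ∧-true (weight φ ≡ᵇ weight ψ) p₁ | _ , vg ← ∧-true (weight φ ≡ᵇ weight ψ) q₁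
  = cong₂ _+_
      (cong₂ (λ w v → + w * v) {x = weight ψ} {y = weight φ} {u = value ψ f' * value ψ g'} (sym (≡ᵇ-true _ _ w))
        (trans (cong₂ _*_ (≟-true (value ψ f') _ vf) (≟-true (value ψ g') _ vg))
          (signed-* (alternating φ) (value φ f) (value φ g))))
      (gram-agree φs ψs p₂ q₂)

forms-bc : ∀ t f g → gram (forms (bc↔ᵗ t)) (bc↔ f) (bc↔ g) ≡ gram (forms t) f g
forms-bc t f g = gram-agree (forms t) (forms (bc↔ᵗ t)) (check f) (check g)
  where check = all-true 6 (all-true 4 {λ t → all 6 λ f → agree (forms t) (forms (bc↔ᵗ t)) f (bc↔ f)} refl t)

forms-cd : ∀ t f g → gram (forms (cd↔ᵗ t)) (cd↔ f) (cd↔ g) ≡ gram (forms t) f g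
forms-cd t f g = gram-agree (forms t) (forms (cd↔ᵗ t)) (check f) (check g)
  where check = all-true 6 (all-true 4 {λ t → all 6 λ f → agree (forms t) (forms (cd↔ᵗ t)) f (cd↔ f)} refl t)

gram-comm : ∀ φs f g → gram φs f g ≡ gram φs g f
gram-comm []       f g = refl
gram-comm (φ ∷ φs) f g = cong₂ _+_ (cong (_*_ (+ weight φ)) (*-comm (value φ f) (value φ g))) (gram-comm φs f g)

square-nonneg : ∀ i → 0ℤ ≤ i * i
square-nonneg (+ n)    = subst (0ℤ ≤_) (pos-* n n) (+≤+ z≤n)
square-nonneg -[1+ n ] = +≤+ z≤n

-- The double sum includes u = v, so each product sums to a square exactly.
gram-psd : {A : Set} (V : List A) (ℓ : A → Link) → ∀ φs →
           0ℤ ≤ ∑ V λ u → ∑ V λ v → gram φs (ℓ u) (ℓ v)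
gram-psd V ℓ []       = ≤-reflexive (sym (trans (∑-cong V λ _ → ∑-zero V) (∑-zero V)))
gram-psd V ℓ (φ ∷ φs) = ≤-trans (0≤+ 0≤sq (gram-psd V ℓ φs)) (≤-reflexive (sym eq))
  where
  x = value φ ∘ ℓ
  w = + weight φ
  0≤sq : 0ℤ ≤ w * (∑ V x * ∑ V x)
  0≤sq = ≤-trans (≤-reflexive (sym (*-zeroʳ w))) (*-monoˡ-≤-nonNeg w (square-nonneg (∑ V x)))
  inner : ∀ u → ∑ V (λ v → w * (x u * x v) + gram φs (ℓ u) (ℓ v)) ≡ (w * ∑ V x) * x u + ∑ V (λ v → gram φs (ℓ u) (ℓ v))
  inner u = trans (∑-+ V (λ v → w * (x u * x v)) _) (cong (_+ ∑ V (λ v → gram φs (ℓ u) (ℓ v)))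
    (trans (∑-* V w (λ v → x u * x v)) (trans (cong (_*_ w) (∑-* V (x u) x)) (lemma w (x u) (∑ V x)))))
    where
    lemma : ∀ a b c → a * (b * c) ≡ (a * c) * b
    lemma = solve-∀
  eq : ∑ V (λ u → ∑ V λ v → gram (φ ∷ φs) (ℓ u) (ℓ v)) ≡ w * (∑ V x * ∑ V x) + ∑ V (λ u → ∑ V λ v → gram φs (ℓ u) (ℓ v))
  eq = trans (∑-cong V inner) (trans (∑-+ V (λ u → (w * ∑ V x) * x u) _)
    (cong (_+ ∑ V (λ u → ∑ V λ v → gram φs (ℓ u) (ℓ v))) (trans (∑-* V (w * ∑ V x) x) (*-assoc w (∑ V x) (∑ V x)))))

-- The quantity to be bounded on six vertices and its symmetry

module _ {n : ℕ} (e : Graph3 n) where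

  trace : Fin n → Fin n → Fin n → Fin n → Trace
  trace a b c d = e a b c ∷ e a b d ∷ e a c d ∷ e b c d ∷ []

  link : Fin n → Fin n → Fin n → Fin n → Fin n → Link
  link a b c d u = e a b u ∷ e a c u ∷ e a d u ∷ e b c u ∷ e b d u ∷ e c d u ∷ []

  pointed : Vec (Fin n) 1 → Vec (Fin n) 3 → Vec (Fin n) 2 → ℤ
  pointed (a ∷ []) (b ∷ c ∷ d ∷ []) (u ∷ v ∷ []) =
    gram (forms (trace a b c d)) (link a b c d u) (link a b c d v)

  -- Summing over the distinguished vertex gives symmetry in all four vertices from the equivariance
  -- of `forms` in the other three.
  square : Vec (Fin n) 4 → Vec (Fin n) 2 → ℤ
  square l m = parts 4 1 3 (λ p q → pointed p q m) l

  hit : Vec (Fin n) 5 → ℤ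
  hit l = β (edges e (toList l) ≡ᵇ 3)

  -- 1749600000 = 27 · 64800000, and 7776000000 below is 120 · 64800000.
  excess : Vec (Fin n) 6 → ℤ
  excess xs = parts 6 5 1 (λ l _ → hit l) xs * + 1749600000 + parts 6 4 2 square xs

module _ {n : ℕ} {e : Graph3 n} (e-sym : Symmetric e) where
  open Symmetric e-sym

  trace-bc : ∀ a b c d → trace e a c b d ≡ bc↔ᵗ (trace e a b c d)
  trace-bc a b c d rewrite swap₂₃ a c b | swap₁₂ c b d = refl

  trace-cd : ∀ a b c d → trace e a b d c ≡ cd↔ᵗ (trace e a b c d)
  trace-cd a b c d rewrite swap₂₃ a d c | swap₂₃ b d c = refl

  link-bc : ∀ a b c d u → link e a c b d u ≡ bc↔ (link e a b c d u)
  link-bc a b c d u rewrite swap₁₂ c b u = refl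

  link-cd : ∀ a b c d u → link e a b d c u ≡ cd↔ (link e a b c d u)
  link-cd a b c d u rewrite swap₁₂ d c u = refl

  pointed-sym₃ : ∀ p m → Sym (λ q → pointed e p q m)
  pointed-sym₃ (a ∷ []) (u ∷ v ∷ []) 0 (b ∷ c ∷ d ∷ [])
    rewrite trace-bc a b c d | link-bc a b c d u | link-bc a b c d v =
    forms-bc (trace e a b c d) (link e a b c d u) (link e a b c d v)
  pointed-sym₃ (a ∷ []) (u ∷ v ∷ []) 1 (b ∷ c ∷ d ∷ [])
    rewrite trace-cd a b c d | link-cd a b c d u | link-cd a b c d v =
    forms-cd (trace e a b c d) (link e a b c d u) (link e a b c d v)
  pointed-sym₃ p m 2 (b ∷ c ∷ d ∷ []) = refl
  pointed-sym₃ p m (suc (suc (suc s))) (b ∷ c ∷ d ∷ []) = refl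

  pointed-sym₂ : ∀ p q → Sym (pointed e p q)
  pointed-sym₂ (a ∷ []) (b ∷ c ∷ d ∷ []) 0 (u ∷ v ∷ []) =
    gram-comm (forms (trace e a b c d)) (link e a b c d v) (link e a b c d u)
  pointed-sym₂ p q 1 (u ∷ v ∷ []) = refl
  pointed-sym₂ p q (suc (suc s)) (u ∷ v ∷ []) = refl

  square-sym₄ : ∀ m → Sym (λ l → square e l m)
  square-sym₄ m = parts-sym 4 1 3 _ (λ q s p → cong (λ p → pointed e p q m) (sw₁ s p)) (λ p → pointed-sym₃ p m)

  square-sym₂ : ∀ l → Sym (square e l)
  square-sym₂ l s m = parts-cong 4 1 3 (λ p q → pointed-sym₂ p q s m) l

  hit-sym : Sym (hit e)
  hit-sym s l = cong (λ k → β (k ≡ᵇ 3)) (edges-sym e-sym s l)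

  excess-sym : Sym (excess e)
  excess-sym s xs = cong₂ (λ h q → h * + 1749600000 + q)
    (parts-sym 6 5 1 _ (λ _ → hit-sym) (λ _ _ _ → refl) s xs)
    (parts-sym 6 4 2 _ square-sym₄ square-sym₂ s xs)

-- The edge indicators of six vertices a, b, c, d, x, y: those without y (base₅) come first.
K : Set
K = Vec Bool 10

-- `square` on bits, with a, b, c, d distinguished in turn; traces and links are rearranged to put
-- the distinguished vertex first.
weigh : Trace → Link → Link → ℤ
weigh (abc ∷ abd ∷ acd ∷ bcd ∷ []) (ab ∷ ac ∷ ad ∷ bc ∷ bd ∷ cd ∷ []) (ab' ∷ ac' ∷ ad' ∷ bc' ∷ bd' ∷ cd' ∷ []) =
  gram (forms (abc ∷ abd ∷ acd ∷ bcd ∷ [])) (ab ∷ ac ∷ ad ∷ bc ∷ bd ∷ cd ∷ []) (ab' ∷ ac' ∷ ad' ∷ bc' ∷ bd' ∷ cd' ∷ []) +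
  (gram (forms (abc ∷ abd ∷ bcd ∷ acd ∷ [])) (ab ∷ bc ∷ bd ∷ ac ∷ ad ∷ cd ∷ []) (ab' ∷ bc' ∷ bd' ∷ ac' ∷ ad' ∷ cd' ∷ []) +
  (gram (forms (abc ∷ acd ∷ bcd ∷ abd ∷ [])) (ac ∷ bc ∷ cd ∷ ab ∷ ad ∷ bd ∷ []) (ac' ∷ bc' ∷ cd' ∷ ab' ∷ ad' ∷ bd' ∷ []) +
  gram (forms (abd ∷ acd ∷ bcd ∷ abc ∷ [])) (ad ∷ bd ∷ cd ∷ ab ∷ ac ∷ bc ∷ []) (ad' ∷ bd' ∷ cd' ∷ ab' ∷ ac' ∷ bc' ∷ [])))

three : K → ℤ
three (p ∷ q ∷ r ∷ s ∷ t ∷ u ∷ v ∷ w ∷ y ∷ z ∷ []) =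
  β (sum (bit p ∷ bit q ∷ bit r ∷ bit s ∷ bit t ∷ bit u ∷ bit v ∷ bit w ∷ bit y ∷ bit z ∷ []) ≡ᵇ 3)

-- Summands and brackets are those that `parts 6 5 1` unfolds to, so that `hits-bits` holds by
-- `refl`.
hits : K → K → ℤ
hits (abc ∷ abd ∷ acd ∷ bcd ∷ abx ∷ acx ∷ adx ∷ bcx ∷ bdx ∷ cdx ∷ [])
     (aby ∷ acy ∷ ady ∷ bcy ∷ bdy ∷ cdy ∷ axy ∷ bxy ∷ cxy ∷ dxy ∷ []) =
    (((((three (abc ∷ abd ∷ abx ∷ acd ∷ acx ∷ adx ∷ bcd ∷ bcx ∷ bdx ∷ cdx ∷ [])
    + three (abc ∷ abd ∷ aby ∷ acd ∷ acy ∷ ady ∷ bcd ∷ bcy ∷ bdy ∷ cdy ∷ []))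
    + three (abc ∷ abx ∷ aby ∷ acx ∷ acy ∷ axy ∷ bcx ∷ bcy ∷ bxy ∷ cxy ∷ []))
    + three (abd ∷ abx ∷ aby ∷ adx ∷ ady ∷ axy ∷ bdx ∷ bdy ∷ bxy ∷ dxy ∷ []))
    + three (acd ∷ acx ∷ acy ∷ adx ∷ ady ∷ axy ∷ cdx ∷ cdy ∷ cxy ∷ dxy ∷ []))
    + three (bcd ∷ bcx ∷ bcy ∷ bdx ∷ bdy ∷ bxy ∷ cdx ∷ cdy ∷ cxy ∷ dxy ∷ []))

-- Bracketed as `parts 6 4 2` unfolds. The kernel Q is a parameter because it is `weigh` in the
-- proof and a table lookup in the computation.
squares : (Trace → Link → Link → ℤ) → K → K → ℤ
squares Q (abc ∷ abd ∷ acd ∷ bcd ∷ abx ∷ acx ∷ adx ∷ bcx ∷ bdx ∷ cdx ∷ [])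
          (aby ∷ acy ∷ ady ∷ bcy ∷ bdy ∷ cdy ∷ axy ∷ bxy ∷ cxy ∷ dxy ∷ []) =
    ((((Q (abc ∷ abd ∷ acd ∷ bcd ∷ []) (abx ∷ acx ∷ adx ∷ bcx ∷ bdx ∷ cdx ∷ []) (aby ∷ acy ∷ ady ∷ bcy ∷ bdy ∷ cdy ∷ [])
    + (Q (abc ∷ abx ∷ acx ∷ bcx ∷ []) (abd ∷ acd ∷ adx ∷ bcd ∷ bdx ∷ cdx ∷ []) (aby ∷ acy ∷ axy ∷ bcy ∷ bxy ∷ cxy ∷ [])
    + Q (abc ∷ aby ∷ acy ∷ bcy ∷ []) (abd ∷ acd ∷ ady ∷ bcd ∷ bdy ∷ cdy ∷ []) (abx ∷ acx ∷ axy ∷ bcx ∷ bxy ∷ cxy ∷ [])))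
    + ((Q (abd ∷ abx ∷ adx ∷ bdx ∷ []) (abc ∷ acd ∷ acx ∷ bcd ∷ bcx ∷ cdx ∷ []) (aby ∷ ady ∷ axy ∷ bdy ∷ bxy ∷ dxy ∷ [])
    + Q (abd ∷ aby ∷ ady ∷ bdy ∷ []) (abc ∷ acd ∷ acy ∷ bcd ∷ bcy ∷ cdy ∷ []) (abx ∷ adx ∷ axy ∷ bdx ∷ bxy ∷ dxy ∷ []))
    + Q (abx ∷ aby ∷ axy ∷ bxy ∷ []) (abc ∷ acx ∷ acy ∷ bcx ∷ bcy ∷ cxy ∷ []) (abd ∷ adx ∷ ady ∷ bdx ∷ bdy ∷ dxy ∷ [])))
    + (((Q (acd ∷ acx ∷ adx ∷ cdx ∷ []) (abc ∷ abd ∷ abx ∷ bcd ∷ bcx ∷ bdx ∷ []) (acy ∷ ady ∷ axy ∷ cdy ∷ cxy ∷ dxy ∷ [])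
    + Q (acd ∷ acy ∷ ady ∷ cdy ∷ []) (abc ∷ abd ∷ aby ∷ bcd ∷ bcy ∷ bdy ∷ []) (acx ∷ adx ∷ axy ∷ cdx ∷ cxy ∷ dxy ∷ []))
    + Q (acx ∷ acy ∷ axy ∷ cxy ∷ []) (abc ∷ abx ∷ aby ∷ bcx ∷ bcy ∷ bxy ∷ []) (acd ∷ adx ∷ ady ∷ cdx ∷ cdy ∷ dxy ∷ []))
    + Q (adx ∷ ady ∷ axy ∷ dxy ∷ []) (abd ∷ abx ∷ aby ∷ bdx ∷ bdy ∷ bxy ∷ []) (acd ∷ acx ∷ acy ∷ cdx ∷ cdy ∷ cxy ∷ [])))
    + ((((Q (bcd ∷ bcx ∷ bdx ∷ cdx ∷ []) (abc ∷ abd ∷ abx ∷ acd ∷ acx ∷ adx ∷ []) (bcy ∷ bdy ∷ bxy ∷ cdy ∷ cxy ∷ dxy ∷ [])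
    + Q (bcd ∷ bcy ∷ bdy ∷ cdy ∷ []) (abc ∷ abd ∷ aby ∷ acd ∷ acy ∷ ady ∷ []) (bcx ∷ bdx ∷ bxy ∷ cdx ∷ cxy ∷ dxy ∷ []))
    + Q (bcx ∷ bcy ∷ bxy ∷ cxy ∷ []) (abc ∷ abx ∷ aby ∷ acx ∷ acy ∷ axy ∷ []) (bcd ∷ bdx ∷ bdy ∷ cdx ∷ cdy ∷ dxy ∷ []))
    + Q (bdx ∷ bdy ∷ bxy ∷ dxy ∷ []) (abd ∷ abx ∷ aby ∷ adx ∷ ady ∷ axy ∷ []) (bcd ∷ bcx ∷ bcy ∷ cdx ∷ cdy ∷ cxy ∷ []))
    + Q (cdx ∷ cdy ∷ cxy ∷ dxy ∷ []) (acd ∷ acx ∷ acy ∷ adx ∷ ady ∷ axy ∷ []) (bcd ∷ bcx ∷ bcy ∷ bdx ∷ bdy ∷ bxy ∷ [])))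

squares-cong : ∀ {Q Q'} → (∀ t f g → Q t f g ≡ Q' t f g) → ∀ k l → squares Q k l ≡ squares Q' k l
squares-cong {Q} {Q'} eq (abc ∷ abd ∷ acd ∷ bcd ∷ abx ∷ acx ∷ adx ∷ bcx ∷ bdx ∷ cdx ∷ [])
                (aby ∷ acy ∷ ady ∷ bcy ∷ bdy ∷ cdy ∷ axy ∷ bxy ∷ cxy ∷ dxy ∷ []) =
  ((((q ⊕ (q ⊕ q)) ⊕ ((q ⊕ q) ⊕ q)) ⊕ (((q ⊕ q) ⊕ q) ⊕ q)) ⊕ ((((q ⊕ q) ⊕ q) ⊕ q) ⊕ q))
  where
  q : ∀ {t f g} → Q t f g ≡ Q' t f g
  q {t} {f} {g} = eq t f g
  _⊕_ = cong₂ _+_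

module _ {n : ℕ} (e : Graph3 n) where

  base₅ last₆ : Vec (Fin n) 6 → K
  base₅ (a ∷ b ∷ c ∷ d ∷ x ∷ y ∷ []) =
    e a b c ∷ e a b d ∷ e a c d ∷ e b c d ∷ e a b x ∷ e a c x ∷ e a d x ∷ e b c x ∷ e b d x ∷ e c d x ∷ []
  last₆ (a ∷ b ∷ c ∷ d ∷ x ∷ y ∷ []) =
    e a b y ∷ e a c y ∷ e a d y ∷ e b c y ∷ e b d y ∷ e c d y ∷ e a x y ∷ e b x y ∷ e c x y ∷ e d x y ∷ []

all₆ : Vec (Fin 6) 6
all₆ = zero ∷ suc zero ∷ suc (suc zero) ∷ suc (suc (suc zero)) ∷ suc (suc (suc (suc zero))) ∷ suc (suc (suc (suc (suc zero)))) ∷ []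

-- With sorted arguments, the sum over the splittings of six concrete positions reduces to an expression in
-- the indicators of the increasing triples.
cmp₁₂ cmp₂₃ : ∀ {n} → Graph3 n → Graph3 n
cmp₁₂ e i j k = if does (j <? i) then e j i k else e i j k
cmp₂₃ e i j k = if does (k <? j) then e i k j else e i j k

sorted : ∀ {n} → Graph3 n → Graph3 n
sorted e = cmp₁₂ (cmp₂₃ (cmp₁₂ e))

_≗₃_ : ∀ {n} → Graph3 n → Graph3 n → Set
e ≗₃ e' = ∀ i j k → e i j k ≡ e' i j k

module _ {n : ℕ} {e : Graph3 n} (e-sym : Symmetric e) where
  open Symmetric e-sym

  cmp₁₂-≗ : ∀ {e'} → e' ≗₃ e → cmp₁₂ e' ≗₃ e
  cmp₁₂-≗ eq i j k with does (j <? i)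
  ... | true  = trans (eq j i k) (swap₁₂ j i k)
  ... | false = eq i j k

  cmp₂₃-≗ : ∀ {e'} → e' ≗₃ e → cmp₂₃ e' ≗₃ e
  cmp₂₃-≗ eq i j k with does (k <? j)
  ... | true  = trans (eq i k j) (swap₂₃ i k j)
  ... | false = eq i j k

  sorted-≗ : sorted e ≗₃ e
  sorted-≗ = cmp₁₂-≗ (cmp₂₃-≗ (cmp₁₂-≗ λ _ _ _ → refl))

square-cong : ∀ {n} {e e' : Graph3 n} → e ≗₃ e' → ∀ l m → square e l m ≡ square e' l m
square-cong {e = e} {e'} eq l (u ∷ v ∷ []) =
  parts-cong 4 1 3 (λ { (a ∷ []) (b ∷ c ∷ d ∷ []) →
    cong₃ (λ t f g → gram (forms t) f g)
      (cong₂ _∷_ (eq a b c) (cong₂ _∷_ (eq a b d) (cong₂ _∷_ (eq a c d) (cong (_∷ []) (eq b c d)))))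
      (link-cong a b c d u) (link-cong a b c d v) }) l
  where
  cong₃ : ∀ {A₁ A₂ A₃ B : Set} (f : A₁ → A₂ → A₃ → B) {a a' b b' c c'} → a ≡ a' → b ≡ b' → c ≡ c' → f a b c ≡ f a' b' c'
  cong₃ f refl refl refl = refl
  link-cong : ∀ a b c d u → link e a b c d u ≡ link e' a b c d u
  link-cong a b c d u = cong₂ _∷_ (eq a b u) (cong₂ _∷_ (eq a c u) (cong₂ _∷_ (eq a d u)
    (cong₂ _∷_ (eq b c u) (cong₂ _∷_ (eq b d u) (cong (_∷ []) (eq c d u))))))

hits-bits : ∀ {n} (e : Graph3 n) xs → parts 6 5 1 (λ l _ → hit e l) xs ≡ hits (base₅ e xs) (last₆ e xs)
hits-bits e (a ∷ b ∷ c ∷ d ∷ x ∷ y ∷ []) = refl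

squares-sorted : ∀ (e : Graph3 6) → parts 6 4 2 (square (sorted e)) all₆ ≡ squares weigh (base₅ e all₆) (last₆ e all₆)
squares-sorted e = refl

-- The graph is pulled back along xs to the six positions. These are distinct and ordered even if
-- entries of xs coincide, so `sorted` can put every triple into increasing order.
squares-bits : ∀ {n} {e : Graph3 n} → Symmetric e → ∀ xs →
  parts 6 4 2 (square e) xs ≡ squares weigh (base₅ e xs) (last₆ e xs)
squares-bits {e = e} e-sym xs@(a ∷ b ∷ c ∷ d ∷ x ∷ y ∷ []) =
  trans (parts-cong 6 4 2 (λ l m → sym (square-cong (sorted-≗ ε-sym) l m)) all₆) (squares-sorted ε)
  where
  ρ = lookup xs
  ε : Graph3 6
  ε i j k = e (ρ i) (ρ j) (ρ k)
  open Symmetric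
  ε-sym : Symmetric ε
  ε-sym = record { swap₁₂ = λ i j k → swap₁₂ e-sym (ρ i) (ρ j) (ρ k) ; swap₂₃ = λ i j k → swap₂₃ e-sym (ρ i) (ρ j) (ρ k) }

excess-bits : ∀ {n} {e : Graph3 n} → Symmetric e → ∀ xs →
  excess e xs ≡ hits (base₅ e xs) (last₆ e xs) * + 1749600000 + squares weigh (base₅ e xs) (last₆ e xs)
excess-bits {e = e} e-sym xs = cong₂ (λ h q → h * + 1749600000 + q) (hits-bits e xs) (squares-bits e-sym xs)

-- The finite check

∨-true : ∀ a {b} → a ∨ b ≡ true → a ≡ true ⊎ b ≡ true
∨-true true  p = inj₁ refl
∨-true false p = inj₂ p

-- The 2¹⁶ values of weigh are tabulated in a tree, whose leaves are evaluated at most once.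
data Tree (A : Set) : ℕ → Set where
  leaf : A → Tree A 0
  node : ∀ {n} → Tree A n → Tree A n → Tree A (suc n)

grow : ∀ {A : Set} n → (Vec Bool n → A) → Tree A n
grow zero    f = leaf (f [])
grow (suc n) f = node (grow n λ v → f (false ∷ v)) (grow n λ v → f (true ∷ v))

look : ∀ {A : Set} {n} → Tree A n → Vec Bool n → A
look (leaf x)   []          = x
look (node l r) (false ∷ v) = look l v
look (node l r) (true  ∷ v) = look r v

look-grow : ∀ {A : Set} n (f : Vec Bool n → A) v → look (grow n f) v ≡ f v
look-grow zero    f []          = refl
look-grow (suc n) f (false ∷ v) = look-grow n _ v
look-grow (suc n) f (true  ∷ v) = look-grow n _ v

Table : Set
Table = Tree (Tree (Tree ℤ 6) 6) 4

byLink : Trace → Link → Tree ℤ 6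
byLink t f = grow 6 (weigh t f)

byTrace : Trace → Tree (Tree ℤ 6) 6
byTrace t = grow 6 (byLink t)

table : Table
table = grow 4 byTrace

entry : Table → Trace → Link → Link → ℤ
entry tb t f g = look (look (look tb t) f) g

entry-table : ∀ t f g → entry table t f g ≡ weigh t f g
entry-table t f g =
  trans (cong (λ x → look (look x f) g) (look-grow 4 byTrace t))
    (trans (cong (λ x → look x g) (look-grow 6 (byLink t) f)) (look-grow 6 (weigh t f) g))

-- Lexicographic reduction by transpositions

infix 4 _≺_
_≺_ : ∀ {n} → Vec Bool n → Vec Bool n → Bool
[]          ≺ []          = false
(false ∷ u) ≺ (false ∷ v) = u ≺ v
(false ∷ u) ≺ (true  ∷ v) = true
(true  ∷ u) ≺ (false ∷ v) = false
(true  ∷ u) ≺ (true  ∷ v) = u ≺ v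

≺-++ : ∀ {m n} (u v : Vec Bool m) {u' v' : Vec Bool n} → (u ≺ v) ≡ true → (u Vec.++ u' ≺ v Vec.++ v') ≡ true
≺-++ []          []          ()
≺-++ (false ∷ u) (false ∷ v) p = ≺-++ u v p
≺-++ (false ∷ u) (true  ∷ v) p = refl
≺-++ (true  ∷ u) (true  ∷ v) p = ≺-++ u v p

-- The binary number with these digits; it carries `≺` into the order of the natural numbers, which
-- makes the descent terminate.
code : ∀ {n} → Vec Bool n → ℕ
code []                  = 0
code (false ∷ v)         = code v
code {suc n} (true ∷ v)  = 2 ^ n ℕ.+ code v

code-< : ∀ {n} (v : Vec Bool n) → code v ℕ.< 2 ^ n
code-< [] = ℕ.s≤s ℕ.z≤n
code-< {suc n} (false ∷ v) = ℕ.<-≤-trans (code-< v) (ℕ.m≤m+n (2 ^ n) _)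
code-< {suc n} (true  ∷ v) = ℕ.+-monoʳ-< (2 ^ n) (ℕ.<-≤-trans (code-< v) (ℕ.≤-reflexive (sym (ℕ.+-identityʳ (2 ^ n)))))

≺⇒code< : ∀ {n} (u v : Vec Bool n) → (u ≺ v) ≡ true → code u ℕ.< code v
≺⇒code< [] [] ()
≺⇒code< (false ∷ u) (false ∷ v) p = ≺⇒code< u v p
≺⇒code< {suc n} (false ∷ u) (true ∷ v) p = ℕ.<-≤-trans (code-< u) (ℕ.m≤m+n (2 ^ n) (code v))
≺⇒code< {suc n} (true ∷ u) (true ∷ v) p = ℕ.+-monoʳ-< (2 ^ n) (≺⇒code< u v p)

-- The action on `base₅` and `last₆` of exchanging neighbours among a, b, c, d, x; the last clauses
-- exchange d and x. As y stays put, the two blocks do not mix. The exchange of x and y does mix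
-- them, hence `swapKL`.
swapK swapL : ℕ → K → K
swapK 0 (abc ∷ abd ∷ acd ∷ bcd ∷ abx ∷ acx ∷ adx ∷ bcx ∷ bdx ∷ cdx ∷ []) =
  abc ∷ abd ∷ bcd ∷ acd ∷ abx ∷ bcx ∷ bdx ∷ acx ∷ adx ∷ cdx ∷ []
swapK 1 (abc ∷ abd ∷ acd ∷ bcd ∷ abx ∷ acx ∷ adx ∷ bcx ∷ bdx ∷ cdx ∷ []) =
  abc ∷ acd ∷ abd ∷ bcd ∷ acx ∷ abx ∷ adx ∷ bcx ∷ cdx ∷ bdx ∷ []
swapK 2 (abc ∷ abd ∷ acd ∷ bcd ∷ abx ∷ acx ∷ adx ∷ bcx ∷ bdx ∷ cdx ∷ []) =
  abd ∷ abc ∷ acd ∷ bcd ∷ abx ∷ adx ∷ acx ∷ bdx ∷ bcx ∷ cdx ∷ []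
swapK _ (abc ∷ abd ∷ acd ∷ bcd ∷ abx ∷ acx ∷ adx ∷ bcx ∷ bdx ∷ cdx ∷ []) =
  abc ∷ abx ∷ acx ∷ bcx ∷ abd ∷ acd ∷ adx ∷ bcd ∷ bdx ∷ cdx ∷ []
swapL 0 (aby ∷ acy ∷ ady ∷ bcy ∷ bdy ∷ cdy ∷ axy ∷ bxy ∷ cxy ∷ dxy ∷ []) =
  aby ∷ bcy ∷ bdy ∷ acy ∷ ady ∷ cdy ∷ bxy ∷ axy ∷ cxy ∷ dxy ∷ []
swapL 1 (aby ∷ acy ∷ ady ∷ bcy ∷ bdy ∷ cdy ∷ axy ∷ bxy ∷ cxy ∷ dxy ∷ []) =
  acy ∷ aby ∷ ady ∷ bcy ∷ cdy ∷ bdy ∷ axy ∷ cxy ∷ bxy ∷ dxy ∷ []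
swapL 2 (aby ∷ acy ∷ ady ∷ bcy ∷ bdy ∷ cdy ∷ axy ∷ bxy ∷ cxy ∷ dxy ∷ []) =
  aby ∷ ady ∷ acy ∷ bdy ∷ bcy ∷ cdy ∷ axy ∷ bxy ∷ dxy ∷ cxy ∷ []
swapL _ (aby ∷ acy ∷ ady ∷ bcy ∷ bdy ∷ cdy ∷ axy ∷ bxy ∷ cxy ∷ dxy ∷ []) =
  aby ∷ acy ∷ axy ∷ bcy ∷ bxy ∷ cxy ∷ ady ∷ bdy ∷ cdy ∷ dxy ∷ []

swapKL : K → K → Vec Bool 20
swapKL (abc ∷ abd ∷ acd ∷ bcd ∷ abx ∷ acx ∷ adx ∷ bcx ∷ bdx ∷ cdx ∷ [])
       (aby ∷ acy ∷ ady ∷ bcy ∷ bdy ∷ cdy ∷ axy ∷ bxy ∷ cxy ∷ dxy ∷ []) =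
  (abc ∷ abd ∷ acd ∷ bcd ∷ aby ∷ acy ∷ ady ∷ bcy ∷ bdy ∷ cdy ∷ []) Vec.++
  (abx ∷ acx ∷ adx ∷ bcx ∷ bdx ∷ cdx ∷ axy ∷ bxy ∷ cxy ∷ dxy ∷ [])

-- The first ten bits are the leading ones, so a decrease there disposes of all 2¹⁰ continuations at
-- once.
reduces₅ : ℕ → K → Bool
reduces₅ s k = swapK s k ≺ k

reduces₆ : ℕ → K → K → Bool
reduces₆ s k l = swapK s k Vec.++ swapL s l ≺ k Vec.++ l

small : Table → K → K → Bool
small tb k l = hits k l * + 1749600000 + squares (entry tb) k l ≤ᵇ + 7776000000

small-≤ : ∀ tb k l → small tb k l ≡ true → hits k l * + 1749600000 + squares (entry tb) k l ≤ + 7776000000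
small-≤ tb k l p = ≤ᵇ⇒≤ (subst T (sym p) tt)

-- Only the labellings that no transposition of neighbours makes lexicographically smaller are examined:
-- 46 of the 2¹⁰ choices on five vertices, about 10⁴ of the 2²⁰ on six.
cell : Table → K → K → Bool
cell tb k l =
  reduces₆ 0 k l ∨ (reduces₆ 1 k l ∨ (reduces₆ 2 k l ∨ (reduces₆ 3 k l ∨ ((swapKL k l ≺ k Vec.++ l) ∨ small tb k l))))

row : Table → K → Bool
row tb k = reduces₅ 0 k ∨ (reduces₅ 1 k ∨ (reduces₅ 2 k ∨ (reduces₅ 3 k ∨ all 10 (cell tb k))))

data Outcome (tb : Table) (k l : K) : Set where
  smaller₅ : ∀ s → s ℕ.< 4 → reduces₅ s k ≡ true → Outcome tb k l
  smaller₆ : ∀ s → s ℕ.< 4 → reduces₆ s k l ≡ true → Outcome tb k l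
  smallerₓ : (swapKL k l ≺ k Vec.++ l) ≡ true → Outcome tb k l
  bounded  : small tb k l ≡ true → Outcome tb k l

first-true : ∀ {A : Set} (f : ℕ → Bool) {b} → (∀ s → s ℕ.< 4 → f s ≡ true → A) → (b ≡ true → A) →
             f 0 ∨ (f 1 ∨ (f 2 ∨ (f 3 ∨ b))) ≡ true → A
first-true f found rest p with ∨-true (f 0) p
... | inj₁ q = found 0 (ℕ.s≤s ℕ.z≤n) q
... | inj₂ p with ∨-true (f 1) p
... | inj₁ q = found 1 (ℕ.s≤s (ℕ.s≤s ℕ.z≤n)) q
... | inj₂ p with ∨-true (f 2) p
... | inj₁ q = found 2 (ℕ.s≤s (ℕ.s≤s (ℕ.s≤s ℕ.z≤n))) q
... | inj₂ p with ∨-true (f 3) p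
... | inj₁ q = found 3 (ℕ.s≤s (ℕ.s≤s (ℕ.s≤s (ℕ.s≤s ℕ.z≤n)))) q
... | inj₂ q = rest q

cell-outcome : ∀ tb k l → cell tb k l ≡ true → Outcome tb k l
cell-outcome tb k l = first-true (λ s → reduces₆ s k l) smaller₆
  (λ p → case-∨ (∨-true (swapKL k l ≺ k Vec.++ l) p))
  where
  case-∨ : (swapKL k l ≺ k Vec.++ l) ≡ true ⊎ small tb k l ≡ true → Outcome tb k l
  case-∨ (inj₁ q) = smallerₓ q
  case-∨ (inj₂ q) = bounded q

row-outcome : ∀ tb k → row tb k ≡ true → ∀ l → Outcome tb k l
row-outcome tb k p l = first-true (λ s → reduces₅ s k) smaller₅
  (λ q → cell-outcome tb k l (all-true 10 {cell tb k} q l)) p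

checked : all 10 (row table) ≡ true
checked = refl

module _ {n : ℕ} {e : Graph3 n} (e-sym : Symmetric e) where
  open Symmetric e-sym

  base-swap : ∀ s → s ℕ.< 4 → ∀ xs → base₅ e (sw s xs) ≡ swapK s (base₅ e xs)
  base-swap 0 _ (a ∷ b ∷ c ∷ d ∷ x ∷ y ∷ [])
    rewrite swap₁₂ b a c | swap₁₂ b a d | swap₁₂ b a x = refl
  base-swap 1 _ (a ∷ b ∷ c ∷ d ∷ x ∷ y ∷ [])
    rewrite swap₂₃ a c b | swap₁₂ c b d | swap₁₂ c b x = refl
  base-swap 2 _ (a ∷ b ∷ c ∷ d ∷ x ∷ y ∷ [])
    rewrite swap₂₃ a d c | swap₂₃ b d c | swap₁₂ d c x = refl
  base-swap 3 _ (a ∷ b ∷ c ∷ d ∷ x ∷ y ∷ [])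
    rewrite swap₂₃ a x d | swap₂₃ b x d | swap₂₃ c x d = refl
  base-swap (suc (suc (suc (suc s)))) (ℕ.s≤s (ℕ.s≤s (ℕ.s≤s (ℕ.s≤s ()))))

  last-swap : ∀ s → s ℕ.< 4 → ∀ xs → last₆ e (sw s xs) ≡ swapL s (last₆ e xs)
  last-swap 0 _ (a ∷ b ∷ c ∷ d ∷ x ∷ y ∷ []) rewrite swap₁₂ b a y = refl
  last-swap 1 _ (a ∷ b ∷ c ∷ d ∷ x ∷ y ∷ []) rewrite swap₁₂ c b y = refl
  last-swap 2 _ (a ∷ b ∷ c ∷ d ∷ x ∷ y ∷ []) rewrite swap₁₂ d c y = refl
  last-swap 3 _ (a ∷ b ∷ c ∷ d ∷ x ∷ y ∷ []) rewrite swap₁₂ x d y = refl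
  last-swap (suc (suc (suc (suc s)))) (ℕ.s≤s (ℕ.s≤s (ℕ.s≤s (ℕ.s≤s ()))))

  bits : Vec (Fin n) 6 → Vec Bool 20
  bits xs = base₅ e xs Vec.++ last₆ e xs

  bits-swap₄ : ∀ xs → bits (sw 4 xs) ≡ swapKL (base₅ e xs) (last₆ e xs)
  bits-swap₄ (a ∷ b ∷ c ∷ d ∷ x ∷ y ∷ [])
    rewrite swap₂₃ a y x | swap₂₃ b y x | swap₂₃ c y x | swap₂₃ d y x = refl

  -- Induction on the 20 bits read as a number: a transposition that lowers them preserves `excess`,
  -- and where the tests find none the bound has been checked. The table is a variable, so that
  -- nothing here evaluates it.
  descend : ∀ tb → (∀ t f g → entry tb t f g ≡ weigh t f g) → (∀ k l → Outcome tb k l) →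
            ∀ xs → excess e xs ≤ + 7776000000
  descend tb correct outcome xs = go xs (<-wellFounded (code (bits xs)))
    where
    go : ∀ xs → Acc ℕ._<_ (code (bits xs)) → excess e xs ≤ + 7776000000
    go xs (acc rec) = conclude (outcome (base₅ e xs) (last₆ e xs))
      where
      improve : ∀ s → (bits (sw s xs) ≺ bits xs) ≡ true → excess e xs ≤ + 7776000000
      improve s p = subst (_≤ + 7776000000) (excess-sym e-sym s xs)
        (go (sw s xs) (rec (≺⇒code< (bits (sw s xs)) (bits xs) p)))

      conclude : Outcome tb (base₅ e xs) (last₆ e xs) → excess e xs ≤ + 7776000000
      conclude (smaller₅ s s<4 p) = improve s (≺-++ (base₅ e (sw s xs)) (base₅ e xs)
        (subst (λ k → (k ≺ base₅ e xs) ≡ true) (sym (base-swap s s<4 xs)) p))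
      conclude (smaller₆ s s<4 p) = improve s
        (subst₂ (λ k l → (k Vec.++ l ≺ bits xs) ≡ true) (sym (base-swap s s<4 xs)) (sym (last-swap s s<4 xs)) p)
      conclude (smallerₓ p) = improve 4 (subst (λ v → (v ≺ bits xs) ≡ true) (sym (bits-swap₄ xs)) p)
      conclude (bounded p) = subst (_≤ + 7776000000)
        (trans (cong (_+_ (hits (base₅ e xs) (last₆ e xs) * + 1749600000)) (squares-cong correct (base₅ e xs) (last₆ e xs)))
               (sym (excess-bits e-sym xs)))
        (small-≤ tb (base₅ e xs) (last₆ e xs) p)

  excess-≤ : ∀ xs → excess e xs ≤ + 7776000000
  excess-≤ = descend table entry-table λ k → row-outcome table k (all-true 10 {row table} checked k)

-- The upper bound

∑-cong-All : ∀ {xs : List A} {f g : A → ℤ} → All (λ x → f x ≡ g x) xs → ∑ xs f ≡ ∑ xs g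
∑-cong-All []         = refl
∑-cong-All (eq ∷ eqs) = cong₂ _+_ eq (∑-cong-All eqs)

choose-All : ∀ {P : A → Set} r {xs} → All P xs → All (All P) (choose r xs)
choose-All zero    ps       = [] ∷ []
choose-All (suc r) []       = []
choose-All (suc r) (p ∷ ps) = All.++⁺ (All.map⁺ (All.map (p ∷_) (choose-All r ps))) (choose-All (suc r) ps)

choose-AllPairs : ∀ {R : A → A → Set} r {xs} → AllPairs R xs → All (AllPairs R) (choose r xs)
choose-AllPairs zero    rs       = [] ∷ []
choose-AllPairs (suc r) []       = []
choose-AllPairs (suc r) (p ∷ rs) =
  All.++⁺ (All.map⁺ (All.zipWith (λ (ps , qs) → ps ∷ qs) (choose-All r p , choose-AllPairs r rs)))
          (choose-AllPairs (suc r) rs)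

module _ {n : ℕ} (G : Graph3 n) where

  increasing : Graph3 n
  increasing a b c = (does (a <? b) ∧ does (b <? c)) ∧ G a b c

  either : Graph3 n
  either a b c = increasing a b c ∨ increasing b a c

  -- G is only meaningful on increasing triples.
  symmetrised : Graph3 n
  symmetrised a b c = either a b c ∨ (either b c a ∨ either c a b)

  either-comm : ∀ a b c → either a b c ≡ either b a c
  either-comm a b c = Bool.∨-comm (increasing a b c) (increasing b a c)

  symmetrised-symmetric : Symmetric symmetrised
  symmetrised-symmetric = record
    { swap₁₂ = λ a b c → cong₂ _∨_ (either-comm a b c)
        (trans (Bool.∨-comm (either b c a) (either c a b)) (cong₂ _∨_ (either-comm c a b) (either-comm b c a)))
    ; swap₂₃ = λ a b c → trans (sym (Bool.∨-assoc (either a b c) (either b c a) (either c a b)))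
        (trans (Bool.∨-comm (either a b c ∨ either b c a) (either c a b))
          (cong₂ _∨_ (either-comm c a b)
            (trans (Bool.∨-comm (either a b c) (either b c a)) (cong₂ _∨_ (either-comm b c a) (either-comm a b c)))))
    }

  -- Of the six orderings only the increasing one passes the guard of `increasing`; the other five
  -- disjuncts are false.
  symmetrised-increasing : ∀ {a b c} → a < b → a < c → b < c → symmetrised a b c ≡ G a b c
  symmetrised-increasing {a} {b} {c} a<b a<c b<c
    rewrite dec-true (a <? b) a<b | dec-true (b <? c) b<c | dec-true (a <? c) a<c
          | dec-false (b <? a) (Fin.<-asym a<b) | dec-false (c <? b) (Fin.<-asym b<c) | dec-false (c <? a) (Fin.<-asym a<c)
    = trans (Bool.∨-identityʳ _) (Bool.∨-identityʳ _)

  symmetrised-isEdge : ∀ {T} → AllPairs _<_ T → isEdge G T ≡ isEdge symmetrised T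
  symmetrised-isEdge [] = refl
  symmetrised-isEdge (_ ∷ []) = refl
  symmetrised-isEdge (_ ∷ (_ ∷ [])) = refl
  symmetrised-isEdge ((a<b ∷ a<c ∷ []) ∷ ((b<c ∷ []) ∷ ([] ∷ []))) = sym (symmetrised-increasing a<b a<c b<c)
  symmetrised-isEdge ((_ ∷ _ ∷ _ ∷ _) ∷ (_ ∷ (_ ∷ (_ ∷ _)))) = refl

  symmetrised-edges : ∀ {S} → AllPairs _<_ S → edges G S ≡ edges symmetrised S
  symmetrised-edges inc = cong sum (go (choose-AllPairs 3 inc))
    where
    go : ∀ {Ts} → All (AllPairs _<_) Ts → map (bit ∘ isEdge G) Ts ≡ map (bit ∘ isEdge symmetrised) Ts
    go []       = refl
    go (p ∷ ps) = cong₂ _∷_ (cong bit (symmetrised-isEdge p)) (go ps)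

allFin-increasing : ∀ n → AllPairs _<_ (allFin n)
allFin-increasing n = AllPairs.tabulate⁺-< id

e≡∑ : ∀ k {n} (G : Graph3 n) → + e[ 5 ∙ k ] G ≡ ∑ (choose 5 (allFin n)) (λ S → β (edges G S ≡ᵇ k))
e≡∑ k {n} G = trans (∑-filter (λ S → edgesIn G S ℕ.≟ k) (choose 5 (allFin n)))
  (∑-cong (choose 5 (allFin n)) λ S → cong (λ m → β (m ≡ᵇ k)) (edgesIn≡edges G S))

∑-const : (xs : List A) (c : ℤ) → ∑ xs (λ _ → c) ≡ + length xs * c
∑-const []       c = refl
∑-const (x ∷ xs) c = trans (cong (_+_ c) (∑-const xs c)) (lemma c (+ length xs))
  where
  lemma : ∀ c n → c + n * c ≡ (1ℤ + n) * c
  lemma = solve-∀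

Σᵗ-const : (V : List A) → ∀ k (c : ℤ) → Σᵗ V k (λ _ → c) ≡ + (length V ^ k) * c
Σᵗ-const V zero    c = sym (*-identityˡ c)
Σᵗ-const V (suc k) c = trans (∑-cong V λ _ → Σᵗ-const V k c) (trans (∑-const V _)
  (trans (sym (*-assoc (+ length V) (+ (length V ^ k)) c)) (cong (_* c) (sym (pos-* (length V) (length V ^ k))))))

Σᵗ-∑-const : (V : List A) → ∀ k (f : Vec A k → ℤ) → Σᵗ V k (λ l → ∑ V λ _ → f l) ≡ + length V * Σᵗ V k f
Σᵗ-∑-const V k f = trans (Σᵗ-cong V k λ l → ∑-const V (f l)) (Σᵗ-* V k (+ length V) f)

Σᵗ-bound : (V : List A) → ∀ k (f g : Vec A k → ℤ) (c b : ℤ) → 0ℤ ≤ Σᵗ V k g →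
           (∀ l → f l * c + g l ≤ b) → Σᵗ V k f * c ≤ + (length V ^ k) * b
Σᵗ-bound V k f g c b 0≤g le = begin
  Σᵗ V k f * c                             ≡⟨ *-comm _ c ⟩
  c * Σᵗ V k f                             ≡⟨ Σᵗ-* V k c f ⟨
  Σᵗ V k (λ l → c * f l)                   ≡⟨ Σᵗ-cong V k (λ l → *-comm c (f l)) ⟩
  Σᵗ V k (λ l → f l * c)                   ≡⟨ +-identityʳ _ ⟨
  Σᵗ V k (λ l → f l * c) + 0ℤ              ≤⟨ +-monoʳ-≤ (Σᵗ V k (λ l → f l * c)) 0≤g ⟩
  Σᵗ V k (λ l → f l * c) + Σᵗ V k g        ≡⟨ Σᵗ-+ V k (λ l → f l * c) g ⟨
  Σᵗ V k (λ l → f l * c + g l)             ≤⟨ Σᵗ-mono V k le ⟩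
  Σᵗ V k (λ _ → b)                         ≡⟨ Σᵗ-const V k b ⟩
  + (length V ^ k) * b                     ∎
  where open ≤-Reasoning

-- A term may be negative for a single m; what is nonnegative is its sum over m, so this sum is
-- distributed over the splittings.
Σᵗ-parts-nonneg : (V : List A) → ∀ r k i j (F : Vec A i → Vec A j → Vec A r → ℤ) →
  (∀ p q → 0ℤ ≤ Σᵗ V r (F p q)) → ∀ l → 0ℤ ≤ Σᵗ V r (λ m → parts k i j (λ p q → F p q m) l)
Σᵗ-parts-nonneg V r zero    zero    zero    F h []      = h [] []
Σᵗ-parts-nonneg V r zero    zero    (suc j) F h []      = ≤-reflexive (sym (Σᵗ-zero V r))
Σᵗ-parts-nonneg V r zero    (suc i) j       F h []      = ≤-reflexive (sym (Σᵗ-zero V r))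
Σᵗ-parts-nonneg V r (suc k) zero    zero    F h (x ∷ l) = ≤-reflexive (sym (Σᵗ-zero V r))
Σᵗ-parts-nonneg V r (suc k) (suc i) zero    F h (x ∷ l) =
  Σᵗ-parts-nonneg V r k i zero (λ p → F (x ∷ p)) (λ p → h (x ∷ p)) l
Σᵗ-parts-nonneg V r (suc k) zero    (suc j) F h (x ∷ l) =
  Σᵗ-parts-nonneg V r k zero j (λ p q → F p (x ∷ q)) (λ p q → h p (x ∷ q)) l
Σᵗ-parts-nonneg V r (suc k) (suc i) (suc j) F h (x ∷ l) = ≤-trans
  (0≤+ (Σᵗ-parts-nonneg V r k i (suc j) (λ p → F (x ∷ p)) (λ p → h (x ∷ p)) l)
       (Σᵗ-parts-nonneg V r k (suc i) j (λ p q → F p (x ∷ q)) (λ p q → h p (x ∷ q)) l))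
  (≤-reflexive (sym (Σᵗ-+ V r _ _)))

module _ {n : ℕ} {e : Graph3 n} (e-sym : Symmetric e) (V : List (Fin n)) where

  Σᵗ-square-nonneg : 0ℤ ≤ Σᵗ V 6 (parts 6 4 2 (square e))
  -- 15 is the number of splittings 6 = 4 + 2.
  Σᵗ-square-nonneg = ≤-trans (≤-reflexive (sym (*-zeroʳ (+ 15)))) (≤-trans
    (*-monoˡ-≤-nonNeg (+ 15) (Σᵗ-nonneg V 4 λ l → Σᵗ-parts-nonneg V 2 4 1 3 (pointed e) psd l))
    (≤-reflexive (sym (Σᵗ-parts V 6 4 2 (square e)))))
    where
    psd : ∀ p q → 0ℤ ≤ Σᵗ V 2 (pointed e p q)
    psd (a ∷ []) (b ∷ c ∷ d ∷ []) = gram-psd V (link e a b c d) (forms (trace e a b c d))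

  Σᵗ-hit-≤ : + length V * Σᵗ V 5 (hit e) * + 6 * + 1749600000 ≤ + (length V ^ 6) * + 7776000000
  -- 6 counts the splittings 6 = 5 + 1; the vertex left out ranges freely and gives the factor
  -- `length V`.
  Σᵗ-hit-≤ = subst (λ x → x * + 1749600000 ≤ + (length V ^ 6) * + 7776000000)
    (trans (Σᵗ-parts V 6 5 1 λ l _ → hit e l)
      (trans (cong (_*_ (+ 6)) (Σᵗ-∑-const V 5 (hit e))) (*-comm (+ 6) (+ length V * Σᵗ V 5 (hit e)))))
    (Σᵗ-bound V 6 (parts 6 5 1 (λ l _ → hit e l)) (parts 6 4 2 (square e)) (+ 1749600000) (+ 7776000000)
      Σᵗ-square-nonneg (excess-≤ e-sym))

-- Asymptotics and densities

absorption : ∀ n k → suc k ℕ.* (suc n C suc k) ≡ suc n ℕ.* (n C k)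
absorption zero    zero    = refl
absorption zero    (suc k) = ℕ.*-zeroʳ (suc (suc k))
absorption (suc n) zero    = begin
  1 ℕ.* (suc (suc n) C 1)       ≡⟨ cong (1 ℕ.*_) (nCk+nC[k+1]≡[n+1]C[k+1] (suc n) 0) ⟨
  1 ℕ.* (1 ℕ.+ (suc n C 1))     ≡⟨ ℕ.*-identityˡ _ ⟩
  suc (suc n C 1)               ≡⟨ cong suc (trans (sym (ℕ.*-identityˡ _)) (absorption n zero)) ⟩
  suc (suc n) ℕ.* 1             ∎
  where open ≡-Reasoning
absorption (suc n) (suc k) = begin
  suc (suc k) ℕ.* (suc (suc n) C suc (suc k))
    ≡⟨ cong (suc (suc k) ℕ.*_) (nCk+nC[k+1]≡[n+1]C[k+1] (suc n) (suc k)) ⟨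
  suc (suc k) ℕ.* ((suc n C suc k) ℕ.+ (suc n C suc (suc k)))
    ≡⟨ regroup (suc k) (suc n C suc k) (suc n C suc (suc k)) ⟩
  (suc n C suc k) ℕ.+ (suc k ℕ.* (suc n C suc k) ℕ.+ suc (suc k) ℕ.* (suc n C suc (suc k)))
    ≡⟨ cong ((suc n C suc k) ℕ.+_) (cong₂ ℕ._+_ (absorption n k) (absorption n (suc k))) ⟩
  (suc n C suc k) ℕ.+ (suc n ℕ.* (n C k) ℕ.+ suc n ℕ.* (n C suc k))
    ≡⟨ cong ((suc n C suc k) ℕ.+_) (trans (sym (ℕ.*-distribˡ-+ (suc n) (n C k) (n C suc k)))
         (cong (suc n ℕ.*_) (nCk+nC[k+1]≡[n+1]C[k+1] n k))) ⟩
  suc (suc n) ℕ.* (suc n C suc k) ∎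
  where
  open ≡-Reasoning
  regroup : ∀ k x y → suc k ℕ.* (x ℕ.+ y) ≡ x ℕ.+ (k ℕ.* x ℕ.+ suc k ℕ.* y)
  regroup = ℕ-Solver.solve-∀

-- Five absorptions, each using up one factor of 120 = 5 · 4 · 3 · 2 · 1.
120*C₅ : ∀ j → 120 ℕ.* ((5 ℕ.+ j) C 5) ≡ (5 ℕ.+ j) ℕ.* ((4 ℕ.+ j) ℕ.* ((3 ℕ.+ j) ℕ.* ((2 ℕ.+ j) ℕ.* (1 ℕ.+ j))))
120*C₅ j = trans (ℕ.*-assoc 24 5 ((5 ℕ.+ j) C 5)) (trans (cong (24 ℕ.*_) (absorption (4 ℕ.+ j) 4))
  (trans (out 6 4 (5 ℕ.+ j) ((4 ℕ.+ j) C 4)) (cong ((5 ℕ.+ j) ℕ.*_) (trans (cong (6 ℕ.*_) (absorption (3 ℕ.+ j) 3))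
  (trans (out 2 3 (4 ℕ.+ j) ((3 ℕ.+ j) C 3)) (cong ((4 ℕ.+ j) ℕ.*_) (trans (cong (2 ℕ.*_) (absorption (2 ℕ.+ j) 2))
  (trans (out 1 2 (3 ℕ.+ j) ((2 ℕ.+ j) C 2)) (cong ((3 ℕ.+ j) ℕ.*_) (trans (cong (1 ℕ.*_) (absorption (1 ℕ.+ j) 1))
  (trans (out 1 1 (2 ℕ.+ j) ((1 ℕ.+ j) C 1)) (cong ((2 ℕ.+ j) ℕ.*_)
    (trans (cong (1 ℕ.*_) (absorption j 0)) (trans (ℕ.*-identityˡ _) (ℕ.*-identityʳ (1 ℕ.+ j))))))))))))))))
  where
  out : ∀ a b n c → a ℕ.* b ℕ.* (n ℕ.* c) ≡ n ℕ.* (a ℕ.* (b ℕ.* c))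
  out = ℕ-Solver.solve-∀

-- 31 = 5 + 10 + 10 + 5 + 1 collects the lower binomial coefficients, each lower power being at most
-- the fourth. The polynomial in p is the exact difference.
suc-^5-≤ : ∀ p → suc (suc p) ^ 5 ℕ.≤ suc p ^ 5 ℕ.+ 31 ℕ.* suc p ^ 4
suc-^5-≤ p = subst (suc (suc p) ^ 5 ℕ.≤_) (expand p) (ℕ.m≤m+n _ (26 ℕ.* p ^ 4 ℕ.+ 94 ℕ.* p ^ 3 ℕ.+ 116 ℕ.* p ^ 2 ℕ.+ 49 ℕ.* p))
  where
  expand : ∀ p → (suc (suc p) ℕ.* (suc (suc p) ℕ.* (suc (suc p) ℕ.* (suc (suc p) ℕ.* (suc (suc p) ℕ.* 1))))) ℕ.+
    (26 ℕ.* (p ℕ.* (p ℕ.* (p ℕ.* (p ℕ.* 1)))) ℕ.+ 94 ℕ.* (p ℕ.* (p ℕ.* (p ℕ.* 1))) ℕ.+ 116 ℕ.* (p ℕ.* (p ℕ.* 1)) ℕ.+ 49 ℕ.* p)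
    ≡ (suc p ℕ.* (suc p ℕ.* (suc p ℕ.* (suc p ℕ.* (suc p ℕ.* 1))))) ℕ.+ 31 ℕ.* (suc p ℕ.* (suc p ℕ.* (suc p ℕ.* (suc p ℕ.* 1))))
  expand = ℕ-Solver.solve-∀

*-^5 : ∀ m n → (m ℕ.* n) ^ 5 ≡ m ^ 5 ℕ.* n ^ 5
*-^5 m n = expand m n
  where
  expand : ∀ m n → ((m ℕ.* n) ℕ.* ((m ℕ.* n) ℕ.* ((m ℕ.* n) ℕ.* ((m ℕ.* n) ℕ.* ((m ℕ.* n) ℕ.* 1)))))
    ≡ (m ℕ.* (m ℕ.* (m ℕ.* (m ℕ.* (m ℕ.* 1))))) ℕ.* (n ℕ.* (n ℕ.* (n ℕ.* (n ℕ.* (n ℕ.* 1)))))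
  expand = ℕ-Solver.solve-∀

-- With M = 31 q, (1 + 6 / x)⁵ ≤ (1 + 1 / M)⁵ ≤ 1 + 31 / M = 1 + 1 / q once x ≥ 6 M.
^5-ratio : ∀ q' x → let q = suc q' in 6 ℕ.* (31 ℕ.* q) ℕ.≤ x → q ℕ.* (x ℕ.+ 6) ^ 5 ℕ.≤ suc q ℕ.* x ^ 5
^5-ratio q' x 6M≤x = ℕ.*-cancelˡ-≤ (M ^ 5) {{ℕ.m^n≢0 M 5}} (begin
  M ^ 5 ℕ.* (q ℕ.* (x ℕ.+ 6) ^ 5)     ≡⟨ regroup (M ^ 5) q ((x ℕ.+ 6) ^ 5) ⟩
  q ℕ.* (M ^ 5 ℕ.* (x ℕ.+ 6) ^ 5)     ≡⟨ cong (q ℕ.*_) (*-^5 M (x ℕ.+ 6)) ⟨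
  q ℕ.* (M ℕ.* (x ℕ.+ 6)) ^ 5         ≤⟨ ℕ.*-monoʳ-≤ q (ℕ.^-monoˡ-≤ 5 linear) ⟩
  q ℕ.* (suc M ℕ.* x) ^ 5             ≡⟨ cong (q ℕ.*_) (*-^5 (suc M) x) ⟩
  q ℕ.* (suc M ^ 5 ℕ.* x ^ 5)         ≡⟨ ℕ.*-assoc q (suc M ^ 5) (x ^ 5) ⟨
  q ℕ.* suc M ^ 5 ℕ.* x ^ 5           ≤⟨ ℕ.*-monoˡ-≤ (x ^ 5) (ℕ.*-monoʳ-≤ q (suc-^5-≤ (ℕ.pred M))) ⟩
  q ℕ.* (M ^ 5 ℕ.+ 31 ℕ.* M ^ 4) ℕ.* x ^ 5 ≡⟨ absorb q (M ^ 4) (x ^ 5) ⟩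
  M ^ 5 ℕ.* (suc q ℕ.* x ^ 5)         ∎)
  where
  open ℕ.≤-Reasoning
  q M : ℕ
  q = suc q'
  M = 31 ℕ.* q
  regroup : ∀ a b c → a ℕ.* (b ℕ.* c) ≡ b ℕ.* (a ℕ.* c)
  regroup = ℕ-Solver.solve-∀
  absorb : ∀ q m y → q ℕ.* (31 ℕ.* q ℕ.* m ℕ.+ 31 ℕ.* m) ℕ.* y ≡ 31 ℕ.* q ℕ.* m ℕ.* (suc q ℕ.* y)
  absorb = ℕ-Solver.solve-∀
  linear : M ℕ.* (x ℕ.+ 6) ℕ.≤ suc M ℕ.* x
  linear = begin
    M ℕ.* (x ℕ.+ 6)       ≡⟨ ℕ.*-distribˡ-+ M x 6 ⟩
    M ℕ.* x ℕ.+ M ℕ.* 6   ≤⟨ ℕ.+-monoʳ-≤ (M ℕ.* x) (ℕ.≤-trans (ℕ.≤-reflexive (ℕ.*-comm M 6)) 6M≤x) ⟩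
    M ℕ.* x ℕ.+ x         ≡⟨ ℕ.+-comm (M ℕ.* x) x ⟩
    suc M ℕ.* x           ∎

^5≤120*C₅ : ∀ j → suc j ^ 5 ℕ.≤ 120 ℕ.* ((5 ℕ.+ j) C 5)
^5≤120*C₅ j = ℕ.≤-trans
  (ℕ.*-mono-≤ (ℕ.m≤n+m (suc j) 4) (ℕ.*-mono-≤ (ℕ.m≤n+m (suc j) 3) (ℕ.*-mono-≤ (ℕ.m≤n+m (suc j) 2)
    (ℕ.*-mono-≤ (ℕ.m≤n+m (suc j) 1) (ℕ.≤-reflexive (ℕ.*-identityʳ (suc j)))))))
  (ℕ.≤-reflexive (sym (120*C₅ j)))

-- With n = 5 + j, the ratio estimate is applied to x = j + 1, for which n + 2 = x + 6; 6 · 31 · q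
-- is the size it requires of x.
threshold : ℕ → ℕ
threshold q = 5 ℕ.+ 6 ℕ.* (31 ℕ.* q)

-- The shift by 2 comes from the lower bound, where a colour class has at most (n + 2) / 3 vertices;
-- the upper bound uses n ≤ n + 2.
C₅-asymptotic : ∀ q' n → let q = suc q' in threshold q ℕ.≤ n →
                q ℕ.* (n ℕ.+ 2) ^ 5 ℕ.≤ suc q ℕ.* (120 ℕ.* (n C 5))
C₅-asymptotic q' n le with j , refl ← ℕ.m≤n⇒∃[o]m+o≡n (ℕ.≤-trans (ℕ.m≤m+n 5 _) le) = begin
  q ℕ.* (5 ℕ.+ j ℕ.+ 2) ^ 5           ≡⟨ cong (λ y → q ℕ.* y ^ 5) (shift j) ⟩
  q ℕ.* (suc j ℕ.+ 6) ^ 5             ≤⟨ ^5-ratio q' (suc j) (ℕ.≤-trans (ℕ.+-cancelˡ-≤ 5 _ _ le) (ℕ.n≤1+n j)) ⟩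
  suc q ℕ.* suc j ^ 5                 ≤⟨ ℕ.*-monoʳ-≤ (suc q) (^5≤120*C₅ j) ⟩
  suc q ℕ.* (120 ℕ.* ((5 ℕ.+ j) C 5)) ∎
  where
  open ℕ.≤-Reasoning
  q : ℕ
  q = suc q'
  shift : ∀ j → 5 ℕ.+ j ℕ.+ 2 ≡ suc j ℕ.+ 6
  shift = ℕ-Solver.solve-∀

-- Integer forms of the density inequalities

toℚᵘ-toℚ : ∀ x → toℚᵘ (toℚ x) ℚᵘ.≃ mkℚᵘ (+ x) 0
toℚᵘ-toℚ x = ℚ.toℚᵘ-fromℚᵘ (mkℚᵘ (+ x) 0)

toℚ-≤-* : ∀ e c r → mkℚᵘ (+ e) 0 ℚᵘ.≤ toℚᵘ r ℚᵘ.* mkℚᵘ (+ c) 0 → toℚ e ℚ.≤ r ℚ.* toℚ c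
toℚ-≤-* e c r le = ℚ.toℚᵘ-cancel-≤ (ℚᵘ.≤-respʳ-≃
  (ℚᵘ.≃-trans (ℚᵘ.*-congˡ {toℚᵘ r} (ℚᵘ.≃-sym (toℚᵘ-toℚ c))) (ℚᵘ.≃-sym (ℚ.toℚᵘ-homo-* r (toℚ c))))
  (ℚᵘ.≤-respˡ-≃ (ℚᵘ.≃-sym (toℚᵘ-toℚ e)) le))

*-≤-toℚ : ∀ e c r → toℚᵘ r ℚᵘ.* mkℚᵘ (+ c) 0 ℚᵘ.≤ mkℚᵘ (+ e) 0 → r ℚ.* toℚ c ℚ.≤ toℚ e
*-≤-toℚ e c r le = ℚ.toℚᵘ-cancel-≤ (ℚᵘ.≤-respʳ-≃ (ℚᵘ.≃-sym (toℚᵘ-toℚ e))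
  (ℚᵘ.≤-respˡ-≃
    (ℚᵘ.≃-trans (ℚᵘ.*-congˡ {toℚᵘ r} (ℚᵘ.≃-sym (toℚᵘ-toℚ c))) (ℚᵘ.≃-sym (ℚ.toℚᵘ-homo-* r (toℚ c)))) le))

module _ (p d-1 : ℕ) .(cop : Coprime (suc p) (suc d-1)) (e c : ℕ) where
  private
    d : ℕ
    d = suc d-1
    ε : ℚ
    ε = mkℚ (+ suc p) d-1 cop
    E C₅ D n : ℤ
    E = + e
    C₅ = + c
    D = + d
    n = + suc p
    denominator : + (27 ℕ.* d ℕ.* 1) ≡ + 27 ℤ.* D
    denominator = trans (cong +_ (ℕ.*-identityʳ (27 ℕ.* d))) (ℤ.pos-* 27 d)

  -- The hypothesis allows an error of 20 / (27 d), below ε = (p + 1) / d. The slack 27 (p + 1) - 20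
  -- = 7 + 27 p is the coefficient in `rest`.
  upper-density : 27 ℕ.* (d ℕ.* e) ℕ.≤ 20 ℕ.* (suc d ℕ.* c) → toℚ e ℚ.≤ (+ 20 / 27 ℚ.+ ε) ℚ.* toℚ c
  upper-density le = toℚ-≤-* e c (+ 20 / 27 ℚ.+ ε)
    (ℚᵘ.≤-respʳ-≃ (ℚᵘ.*-congʳ {mkℚᵘ C₅ 0} (ℚᵘ.≃-sym (ℚ.toℚᵘ-homo-+ (+ 20 / 27) ε))) (*≤* (begin
      E ℤ.* + (27 ℕ.* d ℕ.* 1)                        ≡⟨ cong (E ℤ.*_) denominator ⟩
      E ℤ.* (+ 27 ℤ.* D)                              ≡⟨ assoc E D ⟩
      + 27 ℤ.* (D ℤ.* E)                              ≤⟨ cast ⟩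
      + 20 ℤ.* ((+ 1 ℤ.+ D) ℤ.* C₅)                    ≡⟨ ℤ.+-identityʳ _ ⟨
      + 20 ℤ.* ((+ 1 ℤ.+ D) ℤ.* C₅) ℤ.+ + 0            ≤⟨ ℤ.+-monoʳ-≤ (+ 20 ℤ.* ((+ 1 ℤ.+ D) ℤ.* C₅)) rest ⟩
      + 20 ℤ.* ((+ 1 ℤ.+ D) ℤ.* C₅) ℤ.+ (+ 7 ℤ.+ + 27 ℤ.* + p) ℤ.* C₅ ≡⟨ collect D C₅ (+ p) ⟩
      (+ 20 ℤ.* D ℤ.+ n ℤ.* + 27) ℤ.* C₅ ℤ.* + 1      ∎)))
    where
    open ℤ.≤-Reasoning
    assoc : ∀ e d → e ℤ.* (+ 27 ℤ.* d) ≡ + 27 ℤ.* (d ℤ.* e)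
    assoc = solve-∀
    collect : ∀ d c p → + 20 ℤ.* ((+ 1 ℤ.+ d) ℤ.* c) ℤ.+ (+ 7 ℤ.+ + 27 ℤ.* p) ℤ.* c
              ≡ (+ 20 ℤ.* d ℤ.+ (+ 1 ℤ.+ p) ℤ.* + 27) ℤ.* c ℤ.* + 1
    collect = solve-∀
    cast : + 27 ℤ.* (D ℤ.* E) ℤ.≤ + 20 ℤ.* ((+ 1 ℤ.+ D) ℤ.* C₅)
    cast = subst₂ ℤ._≤_ (trans (ℤ.pos-* 27 (d ℕ.* e)) (cong (+ 27 ℤ.*_) (ℤ.pos-* d e)))
      (trans (ℤ.pos-* 20 (suc d ℕ.* c)) (cong (+ 20 ℤ.*_) (ℤ.pos-* (suc d) c))) (ℤ.+≤+ le)
    rest : + 0 ℤ.≤ (+ 7 ℤ.+ + 27 ℤ.* + p) ℤ.* C₅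
    rest = subst (+ 0 ℤ.≤_) (trans (ℤ.pos-* (7 ℕ.+ 27 ℕ.* p) c)
      (cong (λ x → (+ 7 ℤ.+ x) ℤ.* C₅) (ℤ.pos-* 27 p))) (ℤ.+≤+ z≤n)

  -- The hypothesis bounds the misses by 7/27 of all sets up to an error of 7 / (27 d), leaving the
  -- slack 27 (p + 1) - 7 = 20 + 27 p.
  lower-density : 27 ℕ.* (d ℕ.* c) ℕ.≤ 27 ℕ.* (d ℕ.* e) ℕ.+ 7 ℕ.* (suc d ℕ.* c) →
                  (+ 20 / 27 ℚ.- ε) ℚ.* toℚ c ℚ.≤ toℚ e
  lower-density le = *-≤-toℚ e c (+ 20 / 27 ℚ.- ε)
    (ℚᵘ.≤-respˡ-≃ (ℚᵘ.*-congʳ {mkℚᵘ C₅ 0} (ℚᵘ.≃-sym (ℚ.toℚᵘ-homo-+ (+ 20 / 27) (ℚ.- ε)))) (*≤* (begin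
      (+ 20 ℤ.* D ℤ.+ ℤ.- n ℤ.* + 27) ℤ.* C₅ ℤ.* + 1   ≡⟨ ℤ.+-identityʳ _ ⟨
      (+ 20 ℤ.* D ℤ.+ ℤ.- n ℤ.* + 27) ℤ.* C₅ ℤ.* + 1 ℤ.+ + 0
        ≤⟨ ℤ.+-monoʳ-≤ ((+ 20 ℤ.* D ℤ.+ ℤ.- n ℤ.* + 27) ℤ.* C₅ ℤ.* + 1) rest ⟩
      (+ 20 ℤ.* D ℤ.+ ℤ.- n ℤ.* + 27) ℤ.* C₅ ℤ.* + 1 ℤ.+ (+ 20 ℤ.+ + 27 ℤ.* + p) ℤ.* C₅
        ≡⟨ collect D C₅ (+ p) ⟩
      + 27 ℤ.* (D ℤ.* C₅) ℤ.+ ℤ.- S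
        ≤⟨ ℤ.+-monoˡ-≤ (ℤ.- S) cast ⟩
      + 27 ℤ.* (D ℤ.* E) ℤ.+ S ℤ.+ ℤ.- S              ≡⟨ cancel (+ 27 ℤ.* (D ℤ.* E)) S ⟩
      + 27 ℤ.* (D ℤ.* E)                              ≡⟨ assoc E D ⟨
      E ℤ.* (+ 27 ℤ.* D)                              ≡⟨ cong (E ℤ.*_) denominator ⟨
      E ℤ.* + (27 ℕ.* d ℕ.* 1)                        ∎)))
    where
    open ℤ.≤-Reasoning
    S : ℤ
    S = + 7 ℤ.* ((+ 1 ℤ.+ D) ℤ.* C₅)
    assoc : ∀ e d → e ℤ.* (+ 27 ℤ.* d) ≡ + 27 ℤ.* (d ℤ.* e)
    assoc = solve-∀
    cancel : ∀ a s → a ℤ.+ s ℤ.+ ℤ.- s ≡ a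
    cancel = solve-∀
    collect : ∀ d c p → (+ 20 ℤ.* d ℤ.+ ℤ.- (+ 1 ℤ.+ p) ℤ.* + 27) ℤ.* c ℤ.* + 1 ℤ.+ (+ 20 ℤ.+ + 27 ℤ.* p) ℤ.* c
              ≡ + 27 ℤ.* (d ℤ.* c) ℤ.+ ℤ.- (+ 7 ℤ.* ((+ 1 ℤ.+ d) ℤ.* c))
    collect = solve-∀
    cast : + 27 ℤ.* (D ℤ.* C₅) ℤ.≤ + 27 ℤ.* (D ℤ.* E) ℤ.+ S
    cast = subst₂ ℤ._≤_ (trans (ℤ.pos-* 27 (d ℕ.* c)) (cong (+ 27 ℤ.*_) (ℤ.pos-* d c)))
      (cong₂ ℤ._+_ (trans (ℤ.pos-* 27 (d ℕ.* e)) (cong (+ 27 ℤ.*_) (ℤ.pos-* d e)))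
        (trans (ℤ.pos-* 7 (suc d ℕ.* c)) (cong (+ 7 ℤ.*_) (ℤ.pos-* (suc d) c)))) (ℤ.+≤+ le)
    rest : + 0 ℤ.≤ (+ 20 ℤ.+ + 27 ℤ.* + p) ℤ.* C₅
    rest = subst (+ 0 ℤ.≤_) (trans (ℤ.pos-* (20 ℕ.+ 27 ℕ.* p) c)
      (cong (λ x → (+ 20 ℤ.+ x) ℤ.* C₅) (ℤ.pos-* 27 p))) (ℤ.+≤+ z≤n)

-- The two bounds combined

0≤β : ∀ b → 0ℤ ≤ β b
0≤β b = +≤+ z≤n

rescale : ∀ N h s c p b k .{{_ : ℤ.Positive N}} .{{_ : ℤ.Positive k}} → s * c ≡ k * + 27 → b ≡ k * + 20 →
          N * h * s * c ≤ N * p * b → + 27 * h ≤ + 20 * p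
rescale N h s c p b k sc bk le = *-cancelˡ-≤-pos (+ 27 * h) (+ 20 * p) k (*-cancelˡ-≤-pos _ _ N
  (subst₂ _≤_
    (trans (*-assoc (N * h) s c) (trans (cong (_*_ (N * h)) sc) (shuffle N h k (+ 27))))
    (trans (cong (_*_ (N * p)) bk) (shuffle N p k (+ 20))) le))
  where
  shuffle : ∀ n h k t → n * h * (k * t) ≡ n * (k * (t * h))
  shuffle = solve-∀

Σᵗ-hit-density : ∀ {n} {e : Graph3 n} → Symmetric e → (V : List (Fin n)) .{{_ : ℕ.NonZero (length V)}} →
                 + 27 * Σᵗ V 5 (hit e) ≤ + 20 * + (length V ^ 5)
Σᵗ-hit-density {e = e} e-sym V =
  -- 6 · 1749600000 = 388800000 · 27 and 7776000000 = 388800000 · 20.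
  rescale (+ length V) (Σᵗ V 5 (hit e)) (+ 6) (+ 1749600000) (+ (length V ^ 5)) (+ 7776000000) (+ 388800000)
    {{positive}} refl refl
    (subst (λ x → + length V * Σᵗ V 5 (hit e) * + 6 * + 1749600000 ≤ x * + 7776000000)
      (pos-* (length V) (length V ^ 5)) (Σᵗ-hit-≤ e-sym V))
  where
  positive : ℤ.Positive (+ length V)
  positive = ℤ.positive (ℤ.+<+ (ℕ.>-nonZero⁻¹ (length V)))

upper-count : ∀ n (G : Graph3 n) → 27 ℕ.* (120 ℕ.* e[ 5 ∙ 3 ] G) ℕ.≤ 20 ℕ.* n ^ 5
-- Without vertices the factor `length V` is zero and cannot be cancelled.
upper-count zero      G = z≤n
upper-count n@(suc _) G = drop‿+≤+ (begin
  + (27 ℕ.* (120 ℕ.* e[ 5 ∙ 3 ] G))   ≡⟨ trans (pos-* 27 (120 ℕ.* e[ 5 ∙ 3 ] G)) (cong (_*_ (+ 27)) (pos-* 120 (e[ 5 ∙ 3 ] G))) ⟩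
  + 27 * (+ 120 * + e[ 5 ∙ 3 ] G)      ≤⟨ *-monoˡ-≤-nonNeg (+ 27) below ⟩
  + 27 * Σᵗ V 5 (hit e)                ≤⟨ Σᵗ-hit-density e-sym V {{ℕ.≢-nonZero λ ()}} ⟩
  + 20 * + (length V ^ 5)              ≡⟨ cong (λ N → + 20 * + (N ^ 5)) (length-tabulate {n = n} id) ⟩
  + 20 * + (n ^ 5)                     ≡⟨ pos-* 20 (n ^ 5) ⟨
  + (20 ℕ.* n ^ 5)                     ∎)
  where
  open ≤-Reasoning
  e : Graph3 n
  e = symmetrised G
  e-sym : Symmetric e
  e-sym = symmetrised-symmetric G
  V : List (Fin n)
  V = allFin n
  below : + 120 * + e[ 5 ∙ 3 ] G ≤ Σᵗ V 5 (hit e)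
  below = subst (λ x → + 120 * x ≤ Σᵗ V 5 (hit e))
    (sym (trans (e≡∑ 3 G) (∑-cong-All (All.map (cong (λ k → β (k ≡ᵇ 3)) ∘ symmetrised-edges G)
      (choose-AllPairs 5 (allFin-increasing n))))))
    (choose-≤ 5 V (λ S → β (edges e S ≡ᵇ 3)) (λ S → 0≤β (edges e S ≡ᵇ 3)) (hit-sym e-sym))

-- The cyclic colouring

length-choose : ∀ r (xs : List A) → length (choose r xs) ≡ length xs C r
length-choose zero    xs       = refl
length-choose (suc r) []       = refl
length-choose (suc r) (x ∷ xs) = trans (length-++ (map (x ∷_) (choose r xs)))
  (trans (cong₂ ℕ._+_ (trans (length-map (x ∷_) (choose r xs)) (length-choose r xs)) (length-choose (suc r) xs))
         (nCk+nC[k+1]≡[n+1]C[k+1] (length xs) r))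

next : Fin 3 → Fin 3
next zero             = suc zero
next (suc zero)       = suc (suc zero)
next (suc (suc zero)) = zero

cyclic : Graph3 3
cyclic a b c = doubled a b c ∨ (doubled b c a ∨ doubled c a b)
  where
  doubled : Graph3 3
  doubled a b c = ⌊ a Fin.≟ b ⌋ ∧ ⌊ c Fin.≟ next a ⌋

cyclic-symmetric : Symmetric cyclic
cyclic-symmetric = record
  { swap₁₂ = toWitness {a? = Fin.all? λ a → Fin.all? λ b → Fin.all? λ c → cyclic a b c Bool.≟ cyclic b a c} tt
  ; swap₂₃ = toWitness {a? = Fin.all? λ a → Fin.all? λ b → Fin.all? λ c → cyclic a b c Bool.≟ cyclic a c b} tt
  }

residue : ℕ → Fin 3
residue 0                   = zero
residue 1                   = suc zero
residue 2                   = suc (suc zero)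
residue (suc (suc (suc n))) = residue n

-- n / 3 rounded up, the size of the largest colour class.
thirds : ℕ → ℕ
thirds 0                   = 0
thirds 1                   = 1
thirds 2                   = 1
thirds (suc (suc (suc n))) = suc (thirds n)

thirds-≤ : ∀ n → 3 ℕ.* thirds n ℕ.≤ n ℕ.+ 2
thirds-≤ 0 = z≤n
thirds-≤ 1 = ℕ.≤-refl
thirds-≤ 2 = s≤s (s≤s (s≤s z≤n))
thirds-≤ (suc (suc (suc n))) = ℕ.≤-trans (ℕ.≤-reflexive (ℕ.*-suc 3 (thirds n))) (ℕ.+-monoʳ-≤ 3 (thirds-≤ n))

colours : List (Fin 3)
colours = allFin 3

module _ (ψ : Fin 3 → ℤ) (0≤ψ : ∀ c → 0ℤ ≤ ψ c) where
  private
    Ψ₀ Ψ₁ Ψ₂ : ℤ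
    Ψ₀ = ψ zero
    Ψ₁ = ψ (suc zero)
    Ψ₂ = ψ (suc (suc zero))

  -- Any three consecutive vertices show each colour once; an incomplete last block is completed,
  -- which costs nothing as ψ is nonnegative. General f and g let the induction pass to tails of
  -- `allFin`.
  ∑-residue-≤ : ∀ n (f : Fin n → A) (g : A → ℤ) → (∀ i → g (f i) ≡ ψ (residue (toℕ i))) →
                ∑ (tabulate f) g ≤ + thirds n * ∑ colours ψ
  ∑-residue-≤ 0 f g eq = ≤-refl
  ∑-residue-≤ 1 f g eq = ≤-trans (+-mono-≤ (≤-reflexive (eq zero)) (∑-nonneg (suc zero ∷ suc (suc zero) ∷ []) 0≤ψ))
    (≤-reflexive (sym (*-identityˡ (∑ colours ψ))))
  ∑-residue-≤ 2 f g eq = ≤-trans (+-mono-≤ (≤-reflexive (eq zero))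
      (+-mono-≤ (≤-reflexive (eq (suc zero))) (∑-nonneg (suc (suc zero) ∷ []) 0≤ψ)))
    (≤-reflexive (sym (*-identityˡ (∑ colours ψ))))
  ∑-residue-≤ (suc (suc (suc n))) f g eq = begin
    g (f zero) + (g (f (suc zero)) + (g (f (suc (suc zero))) + rest))
      ≡⟨ cong₂ _+_ (eq zero) (cong₂ _+_ (eq (suc zero)) (cong (_+ rest) (eq (suc (suc zero))))) ⟩
    Ψ₀ + (Ψ₁ + (Ψ₂ + rest))
      ≤⟨ +-monoʳ-≤ Ψ₀ (+-monoʳ-≤ Ψ₁ (+-monoʳ-≤ Ψ₂ (∑-residue-≤ n (λ i → f (suc (suc (suc i)))) g (λ i → eq (suc (suc (suc i))))))) ⟩
    Ψ₀ + (Ψ₁ + (Ψ₂ + + thirds n * ∑ colours ψ))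
      ≡⟨ regroup Ψ₀ Ψ₁ Ψ₂ (+ thirds n) ⟩
    + suc (thirds n) * ∑ colours ψ ∎
    where
    open ≤-Reasoning
    rest = ∑ (tabulate (λ i → f (suc (suc (suc i))))) g
    regroup : ∀ a b c t → a + (b + (c + t * (a + (b + (c + 0ℤ))))) ≡ (1ℤ + t) * (a + (b + (c + 0ℤ)))
    regroup = solve-∀

-- `choose-≤` bounds counts of subsets from above only, so the lower bound on hits is obtained by
-- bounding their complement.
miss : ∀ {n} → Graph3 n → List (Fin n) → ℤ
miss e S = β (not (edges e S ≡ᵇ 3))

hit+miss : ∀ b → β b + β (not b) ≡ 1ℤ
hit+miss false = refl
hit+miss true  = refl

-- 63 / 3⁵ = 7 / 27 = 1 - 20 / 27.
cyclic-misses : Σᵗ colours 5 (miss cyclic ∘ toList) ≡ + 63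
cyclic-misses = refl

module _ (n : ℕ) where
  colour : Fin n → Fin 3
  colour i = residue (toℕ i)

  colouring : Graph3 n
  colouring i j k = cyclic (colour i) (colour j) (colour k)

  colouring-symmetric : Symmetric colouring
  colouring-symmetric = record
    { swap₁₂ = λ i j k → Symmetric.swap₁₂ cyclic-symmetric (colour i) (colour j) (colour k)
    ; swap₂₃ = λ i j k → Symmetric.swap₂₃ cyclic-symmetric (colour i) (colour j) (colour k) }

  Σᵗ-colour-≤ : ∀ k (φ : Vec (Fin 3) k → ℤ) → (∀ l → 0ℤ ≤ φ l) →
                Σᵗ (allFin n) k (φ ∘ Vec.map colour) ≤ + (thirds n ^ k) * Σᵗ colours k φ
  Σᵗ-colour-≤ zero    φ 0≤φ = ≤-reflexive (sym (*-identityˡ _))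
  Σᵗ-colour-≤ (suc k) φ 0≤φ = begin
    ∑ (allFin n) (λ i → Σᵗ (allFin n) k λ l → φ (colour i ∷ Vec.map colour l))
      ≤⟨ ∑-mono (allFin n) (λ i → Σᵗ-colour-≤ k (λ l → φ (colour i ∷ l)) λ l → 0≤φ (colour i ∷ l)) ⟩
    ∑ (allFin n) (λ i → m * ψ (colour i))
      ≡⟨ ∑-* (allFin n) m (ψ ∘ colour) ⟩
    m * ∑ (allFin n) (ψ ∘ colour)
      ≤⟨ *-monoˡ-≤-nonNeg m (∑-residue-≤ ψ (λ c → Σᵗ-nonneg colours k λ l → 0≤φ (c ∷ l)) n id (ψ ∘ colour) λ _ → refl) ⟩
    m * (+ thirds n * ∑ colours ψ)
      ≡⟨ trans (sym (*-assoc m (+ thirds n) _)) (cong (_* ∑ colours ψ) (trans (*-comm m (+ thirds n)) (sym (pos-* (thirds n) _)))) ⟩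
    + (thirds n ^ suc k) * ∑ colours ψ ∎
    where
    open ≤-Reasoning
    m : ℤ
    m = + (thirds n ^ k)
    ψ : Fin 3 → ℤ
    ψ c = Σᵗ colours k λ l → φ (c ∷ l)

  colouring-miss : ∀ (l : Vec (Fin n) 5) → miss colouring (toList l) ≡ miss cyclic (toList (Vec.map colour l))
  colouring-miss (a ∷ b ∷ c ∷ d ∷ x ∷ []) = refl

  misses-≤ : + 120 * ∑ (choose 5 (allFin n)) (miss colouring) ≤ + (thirds n ^ 5) * + 63
  misses-≤ = ≤-trans
    (choose-≤ 5 (allFin n) (miss colouring) (λ S → 0≤β (not (edges colouring S ≡ᵇ 3)))
      (λ s l → cong (λ k → β (not (k ≡ᵇ 3))) (edges-sym colouring-symmetric s l)))
    (≤-trans (≤-reflexive (Σᵗ-cong (allFin n) 5 colouring-miss))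
      (subst (λ x → Σᵗ (allFin n) 5 (miss cyclic ∘ toList ∘ Vec.map colour) ≤ + (thirds n ^ 5) * x) cyclic-misses
        (Σᵗ-colour-≤ 5 (miss cyclic ∘ toList) (λ l → 0≤β (not (edges cyclic (toList l) ≡ᵇ 3))))))

  hits+misses : + e[ 5 ∙ 3 ] colouring + ∑ (choose 5 (allFin n)) (miss colouring) ≡ + (n C 5)
  hits+misses = begin
    + e[ 5 ∙ 3 ] colouring + ∑ Ss (miss colouring)
      ≡⟨ cong (_+ ∑ Ss (miss colouring)) (e≡∑ 3 colouring) ⟩
    ∑ Ss (λ S → β (edges colouring S ≡ᵇ 3)) + ∑ Ss (miss colouring)
      ≡⟨ ∑-+ Ss (λ S → β (edges colouring S ≡ᵇ 3)) (miss colouring) ⟨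
    ∑ Ss (λ S → β (edges colouring S ≡ᵇ 3) + miss colouring S)
      ≡⟨ ∑-cong Ss (λ S → hit+miss (edges colouring S ≡ᵇ 3)) ⟩
    ∑ Ss (λ _ → 1ℤ)
      ≡⟨ trans (∑-const Ss 1ℤ) (*-identityʳ (+ length Ss)) ⟩
    + length Ss
      ≡⟨ cong +_ (trans (length-choose 5 (allFin n)) (cong (_C 5) (length-tabulate {n = n} id))) ⟩
    + (n C 5) ∎
    where
    open ≡-Reasoning
    Ss = choose 5 (allFin n)

  lower-count : 27 ℕ.* (120 ℕ.* (n C 5)) ℕ.≤ 27 ℕ.* (120 ℕ.* e[ 5 ∙ 3 ] colouring) ℕ.+ 7 ℕ.* (n ℕ.+ 2) ^ 5
  lower-count = ℕ.≤-trans (ℕ.*-monoʳ-≤ 27 (drop‿+≤+ (begin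
    + (120 ℕ.* (n C 5))      ≡⟨ trans (pos-* 120 (n C 5)) (cong (_*_ (+ 120)) (sym hits+misses)) ⟩
    + 120 * (+ h + M)        ≡⟨ *-distribˡ-+ (+ 120) (+ h) M ⟩
    + 120 * + h + + 120 * M  ≤⟨ +-monoʳ-≤ (+ 120 * + h) misses-≤ ⟩
    + 120 * + h + + (thirds n ^ 5) * + 63
                             ≡⟨ cong₂ _+_ (pos-* 120 h) (pos-* (thirds n ^ 5) 63) ⟨
    + (120 ℕ.* h ℕ.+ thirds n ^ 5 ℕ.* 63) ∎)))
    -- 27 · 63 = 7 · 243, and 243 = 3⁵ joins the power of `thirds n`, where three times `thirds n`
    -- is at most n + 2.
    (ℕ.≤-trans (ℕ.≤-reflexive (regroup h (thirds n ^ 5)))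
      (ℕ.+-monoʳ-≤ (27 ℕ.* (120 ℕ.* h)) (ℕ.*-monoʳ-≤ 7
        (ℕ.≤-trans (ℕ.≤-reflexive (sym (*-^5 3 (thirds n)))) (ℕ.^-monoˡ-≤ 5 (thirds-≤ n))))))
    where
    open ≤-Reasoning
    h : ℕ
    h = e[ 5 ∙ 3 ] colouring
    M : ℤ
    M = ∑ (choose 5 (allFin n)) (miss colouring)
    regroup : ∀ h t → 27 ℕ.* (120 ℕ.* h ℕ.+ t ℕ.* 63) ≡ 27 ℕ.* (120 ℕ.* h) ℕ.+ 7 ℕ.* (243 ℕ.* t)
    regroup = ℕ-Solver.solve-∀

-- Passage to the limit

upper-ε : ∀ q' n (G : Graph3 n) → let q = suc q' in threshold q ℕ.≤ n →
          27 ℕ.* (q ℕ.* e[ 5 ∙ 3 ] G) ℕ.≤ 20 ℕ.* (suc q ℕ.* (n C 5))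
upper-ε q' n G le = ℕ.*-cancelˡ-≤ 120 (begin
  120 ℕ.* (27 ℕ.* (q ℕ.* h))           ≡⟨ regroup q h 27 ⟩
  q ℕ.* (27 ℕ.* (120 ℕ.* h))           ≤⟨ ℕ.*-monoʳ-≤ q (upper-count n G) ⟩
  q ℕ.* (20 ℕ.* n ^ 5)                 ≤⟨ ℕ.*-monoʳ-≤ q (ℕ.*-monoʳ-≤ 20 (ℕ.^-monoˡ-≤ 5 (ℕ.m≤m+n n 2))) ⟩
  q ℕ.* (20 ℕ.* (n ℕ.+ 2) ^ 5)         ≡⟨ swap q 20 ((n ℕ.+ 2) ^ 5) ⟩
  20 ℕ.* (q ℕ.* (n ℕ.+ 2) ^ 5)         ≤⟨ ℕ.*-monoʳ-≤ 20 (C₅-asymptotic q' n le) ⟩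
  20 ℕ.* (suc q ℕ.* (120 ℕ.* (n C 5))) ≡⟨ regroup′ (suc q) (n C 5) 20 ⟩
  120 ℕ.* (20 ℕ.* (suc q ℕ.* (n C 5))) ∎)
  where
  open ℕ.≤-Reasoning
  q h : ℕ
  q = suc q'
  h = e[ 5 ∙ 3 ] G
  swap : ∀ a b c → a ℕ.* (b ℕ.* c) ≡ b ℕ.* (a ℕ.* c)
  swap = ℕ-Solver.solve-∀
  regroup : ∀ q h t → 120 ℕ.* (t ℕ.* (q ℕ.* h)) ≡ q ℕ.* (t ℕ.* (120 ℕ.* h))
  regroup = ℕ-Solver.solve-∀
  regroup′ : ∀ q h t → t ℕ.* (q ℕ.* (120 ℕ.* h)) ≡ 120 ℕ.* (t ℕ.* (q ℕ.* h))
  regroup′ = ℕ-Solver.solve-∀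

lower-ε : ∀ q' n → let q = suc q' in threshold q ℕ.≤ n →
          27 ℕ.* (q ℕ.* (n C 5)) ℕ.≤ 27 ℕ.* (q ℕ.* e[ 5 ∙ 3 ] (colouring n)) ℕ.+ 7 ℕ.* (suc q ℕ.* (n C 5))
lower-ε q' n le = ℕ.*-cancelˡ-≤ 120 (begin
  120 ℕ.* (27 ℕ.* (q ℕ.* c))                                  ≡⟨ regroup q c ⟩
  q ℕ.* (27 ℕ.* (120 ℕ.* c))                                  ≤⟨ ℕ.*-monoʳ-≤ q (lower-count n) ⟩
  q ℕ.* (27 ℕ.* (120 ℕ.* h) ℕ.+ 7 ℕ.* (n ℕ.+ 2) ^ 5)          ≡⟨ distribute q h ((n ℕ.+ 2) ^ 5) ⟩
  27 ℕ.* (q ℕ.* (120 ℕ.* h)) ℕ.+ 7 ℕ.* (q ℕ.* (n ℕ.+ 2) ^ 5)  ≤⟨ ℕ.+-monoʳ-≤ (27 ℕ.* (q ℕ.* (120 ℕ.* h))) (ℕ.*-monoʳ-≤ 7 (C₅-asymptotic q' n le)) ⟩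
  27 ℕ.* (q ℕ.* (120 ℕ.* h)) ℕ.+ 7 ℕ.* (suc q ℕ.* (120 ℕ.* c)) ≡⟨ collect q h c ⟩
  120 ℕ.* (27 ℕ.* (q ℕ.* h) ℕ.+ 7 ℕ.* (suc q ℕ.* c))          ∎)
  where
  open ℕ.≤-Reasoning
  q h c : ℕ
  q = suc q'
  h = e[ 5 ∙ 3 ] (colouring n)
  c = n C 5
  regroup : ∀ q c → 120 ℕ.* (27 ℕ.* (q ℕ.* c)) ≡ q ℕ.* (27 ℕ.* (120 ℕ.* c))
  regroup = ℕ-Solver.solve-∀
  distribute : ∀ q h t → q ℕ.* (27 ℕ.* (120 ℕ.* h) ℕ.+ 7 ℕ.* t) ≡ 27 ℕ.* (q ℕ.* (120 ℕ.* h)) ℕ.+ 7 ℕ.* (q ℕ.* t)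
  distribute = ℕ-Solver.solve-∀
  collect : ∀ q h c → 27 ℕ.* (q ℕ.* (120 ℕ.* h)) ℕ.+ 7 ℕ.* (suc q ℕ.* (120 ℕ.* c)) ≡ 120 ℕ.* (27 ℕ.* (q ℕ.* h) ℕ.+ 7 ℕ.* (suc q ℕ.* c))
  collect = ℕ-Solver.solve-∀

π₅₃ : PiIs 5 3 (+ 20 / 27)
-- The numerator of ε is at least 1, so its denominator alone decides how large n must be.
π₅₃ (mkℚ (+ suc p) d-1 cop) _ = threshold (suc d-1) , λ n n≥N →
  (λ G → upper-density p d-1 cop (e[ 5 ∙ 3 ] G) (n C 5) (upper-ε d-1 n G n≥N)) ,
  colouring n , lower-density p d-1 cop (e[ 5 ∙ 3 ] (colouring n)) (n C 5) (lower-ε d-1 n n≥N)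
π₅₃ (mkℚ (+ zero) d-1 cop) record { pos = () }
π₅₃ (mkℚ ℤ.-[1+ p ] d-1 cop) record { pos = () }

-- Complementation

complement : ∀ {n} → Graph3 n → Graph3 n
complement G a b c = not (G a b c)

edges-complement : ∀ {n} (G : Graph3 n) (l : Vec (Fin n) 5) → edges G (toList l) ℕ.+ edges (complement G) (toList l) ≡ 10
edges-complement G (a ∷ b ∷ c ∷ d ∷ x ∷ []) =
  pair (G a b c) (pair (G a b d) (pair (G a b x) (pair (G a c d) (pair (G a c x)
    (pair (G a d x) (pair (G b c d) (pair (G b c x) (pair (G b d x) (pair (G c d x) refl)))))))))
  where
  pair : ∀ b {m m' k} → m ℕ.+ m' ≡ k → (bit b ℕ.+ m) ℕ.+ (bit (not b) ℕ.+ m') ≡ suc k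
  pair true  refl = refl
  pair false {m} {m'} refl = ℕ.+-suc m m'

complement-≡ᵇ : ∀ m m' → m ℕ.+ m' ≡ 10 → (m ≡ᵇ 7) ≡ (m' ≡ᵇ 3)
complement-≡ᵇ 0  _ refl = refl
complement-≡ᵇ 1  _ refl = refl
complement-≡ᵇ 2  _ refl = refl
complement-≡ᵇ 3  _ refl = refl
complement-≡ᵇ 4  _ refl = refl
complement-≡ᵇ 5  _ refl = refl
complement-≡ᵇ 6  _ refl = refl
complement-≡ᵇ 7  _ refl = refl
complement-≡ᵇ 8  _ refl = refl
complement-≡ᵇ 9  _ refl = refl
complement-≡ᵇ 10 _ refl = refl

-- `edges-complement` speaks of exactly five vertices, while the entries of `choose` are lists,
-- whose length has to be recovered.
choose-length : ∀ r (xs : List A) → All (λ S → Σ (Vec A r) λ l → S ≡ toList l) (choose r xs)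
choose-length zero    xs       = ([] , refl) ∷ []
choose-length (suc r) []       = []
choose-length (suc r) (x ∷ xs) = All.++⁺
  (All.map⁺ (All.map (λ (l , eq) → x ∷ l , cong (x ∷_) eq) (choose-length r xs)))
  (choose-length (suc r) xs)

e-complement : ∀ {n} (G G' : Graph3 n) k k' →
  (∀ l → (edges G (toList l) ≡ᵇ k) ≡ (edges G' (toList {n = 5} l) ≡ᵇ k')) → e[ 5 ∙ k ] G ≡ e[ 5 ∙ k' ] G'
e-complement {n} G G' k k' eq = +-injective (trans (e≡∑ k G) (trans
  (∑-cong-All (All.map (λ { (l , refl) → cong β (eq l) }) (choose-length 5 (allFin n)))) (sym (e≡∑ k' G'))))

edges-complement-≡ᵇ : ∀ {n} (G : Graph3 n) l →
  (edges G (toList l) ≡ᵇ 7) ≡ (edges (complement G) (toList {n = 5} l) ≡ᵇ 3)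
edges-complement-≡ᵇ G l =
  complement-≡ᵇ (edges G (toList l)) (edges (complement G) (toList l)) (edges-complement G l)

edges-complement-≡ᵇ′ : ∀ {n} (G : Graph3 n) l →
  (edges G (toList l) ≡ᵇ 3) ≡ (edges (complement G) (toList {n = 5} l) ≡ᵇ 7)
edges-complement-≡ᵇ′ G l = sym (complement-≡ᵇ (edges (complement G) (toList l)) (edges G (toList l))
  (trans (ℕ.+-comm (edges (complement G) (toList l)) (edges G (toList l))) (edges-complement G l)))

e₇≡e₃ : ∀ {n} (G : Graph3 n) → e[ 5 ∙ 7 ] G ≡ e[ 5 ∙ 3 ] (complement G)
e₇≡e₃ G = e-complement G (complement G) 7 3 (edges-complement-≡ᵇ G)

e₃≡e₇ : ∀ {n} (G : Graph3 n) → e[ 5 ∙ 3 ] G ≡ e[ 5 ∙ 7 ] (complement G)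
e₃≡e₇ G = e-complement G (complement G) 3 7 (edges-complement-≡ᵇ′ G)

π₅₃⇒π₅₇ : ∀ r → PiIs 5 3 r → PiIs 5 7 r
π₅₃⇒π₅₇ r π ε ε>0 = proj₁ (π ε ε>0) , λ n n≥N → transfer n (proj₂ (π ε ε>0) n n≥N)
  where
  bound : (m : ℕ) → ∀ n → Graph3 n → Set
  bound k n G = toℚ (e[ 5 ∙ k ] G) ℚ.≤ (r ℚ.+ ε) ℚ.* toℚ (n C 5)
  attained : (m : ℕ) → ∀ n → Graph3 n → Set
  attained k n G = (r ℚ.- ε) ℚ.* toℚ (n C 5) ℚ.≤ toℚ (e[ 5 ∙ k ] G)
  transfer : ∀ n → (∀ G → bound 3 n G) × Σ (Graph3 n) (attained 3 n) → (∀ G → bound 7 n G) × Σ (Graph3 n) (attained 7 n)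
  transfer n (upper , G , lower) =
    (λ G → subst (λ x → toℚ x ℚ.≤ (r ℚ.+ ε) ℚ.* toℚ (n C 5)) (sym (e₇≡e₃ G)) (upper (complement G))) ,
    complement G , subst (λ x → (r ℚ.- ε) ℚ.* toℚ (n C 5) ℚ.≤ toℚ x) (e₃≡e₇ G) lower

theorem2p30 : PiIs 5 3 (+ 20 / 27) × PiIs 5 7 (+ 20 / 27)
theorem2p30 = π₅₃ , π₅₃⇒π₅₇ (+ 20 / 27) π₅₃
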